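{- (Gödel's Completeness Theorem for quantifier theories.) Let $\mathbf A$ be a global locally finite quantifier theory, let $X$ be an infinite set and let $J$ be a consistent subset of $\mathbf A_*(X)$. (a) There is an infinite set $X^+$ containing $X$ and a perfect ultrafilter $I$ of $\mathbf A_*(X^+)$ containing $\{p\kappa_X\mid p\in J\}$, where $\kappa_X:X\to X^+$ is the inclusion map (regarded as a map $X\to\mathbf A^*(X^+)$). (b) For $X^+$ and $I$ as in (a), the modification $\mathbf A[X^+]/I$ of $\mathbf A$ is a $2$-model of $\mathbf A$, and in it $p\kappa_X=1$ for every $p\in J$.
   Context: Throughout, $\mathcal S$ is a nonempty collection of sets containing at least one infinite set; $X,Y,Z,W$ denote members of $\mathcal S$ (sets of variables). Quantifier theory. A quantifier theory $\mathbf A$ over $\mathcal S$ consists of: a set $\mathbf A^*(X)$ and a map $\epsilon_X:X\to\mathbf A^*(X)$ for each $X$ (one writes $x$ for $\epsilon_X(x)$); a Boolean algebra $\mathbf A_*(X)$ for each $X$; an element $a\sigma\in\mathbf A^*(Y)$ for each nonempty $X$, $a\in\mathbf A^*(X)$ and map $\sigma:X\to\mathbf A^*(Y)$; an element $p\sigma\in\mathbf A_*(Y)$ for each nonempty $X$, $p\in\mathbf A_*(X)$ and map $\sigma:X\to\mathbf A^*(Y)$; an element $\forall x.p\in\mathbf A_*(X)$ for each nonempty $X$, $x\in X$, $p\in\mathbf A_*(X)$. Put $\mathbf A(X)=\mathbf A_*(X)\cup\mathbf A^*(X)$. For all nonempty $X$, $x\in X$, $t\in\mathbf A(X)$, $\sigma:X\to\mathbf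 A^*(Y)$, $p,q\in\mathbf A_*(X)$ the following hold. (P1) $t\epsilon_X=t$. (P2) $(t\sigma)\tau=t(\sigma\tau)$ if $Y$ is nonempty and $\tau:Y\to\mathbf A^*(W)$, where $(\sigma\tau)(x)=\sigma(x)\tau$. (P3) $x\sigma=\sigma(x)$. (P4) $p\mapsto p\sigma$ is a homomorphism of Boolean algebras $\mathbf A_*(X)\to\mathbf A_*(Y)$. (P5) $(\forall x.p)\sigma=\forall y.(p\sigma^{y/x})$ whenever $y,z\in Y$, $y\ne z$ and $\sigma[z/y]=\sigma$. (Q1) $\forall x.(p\wedge q)=\forall x.p\wedge\forall x.q$. (Q2) $\forall x.p\le p$. (Q3) $\forall x.p=p$ if $p[y/x]=p$ for some $y\in X$, $y\neq x$. Notation: for $y\in Y$ and $d\in\mathbf A^*(Y)$, $[d/y]:Y\to\mathbf A^*(Y)$ sends $y$ to $d$ and every other variable to itself; for $d\in \mathbf A^*(Y)$, $\sigma^{d/x}:X\to\mathbf A^*(Y)$ sends $x$ to $d$ and agrees with $\sigma$ elsewhere. Supports. For nonempty $X$ and $t\in\mathbf A(X)$, a subset $U\subseteq X$ is a support for $t$ if $t\sigma=t\tau$ for all $Y$ and all $\sigma,\tau:X\to\mathbf A^*(Y)$ with $\sigma|_U=\tau|_U$; $t$ is closed if $\emptyset$ is a support for $t$ (elements of $\mathbf A(\emptyset)$ are by definition closed). $\mathbf A$ is locally finite if every element of every $\mathbf A(X)$ has a finite support. Standing convention: every quantifier theory considered is nontrivial, meaning that $\mathbf A_*(X)$ has a non-closed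 element for some nonempty $X\in\mathcal S$. A theory is global if $\mathcal S$ is the collection of all sets. Models. A quantifier model is a quantifier theory $\mathbf B$ over a collection containing $\emptyset$ such that (M1) $\mathbf B^*(\emptyset)\neq\emptyset$ and $\mathbf B_*(\emptyset)$ is a nontrivial Boolean algebra ($0\ne1$); (M2) for nonempty $X$, $x\in X$, $p\in\mathbf B_*(X)$, $\sigma:X\to\mathbf B^*(\emptyset)$, the infimum $\bigwedge_{d\in\mathbf B^*(\emptyset)}p\sigma^{d/x}$ exists in $\mathbf B_*(\emptyset)$ and equals $(\forall x.p)\sigma$. It is a $2$-model if $\mathbf B_*(\emptyset)=2=\{0,1\}$. A modification (resp. model, $2$-model) of a quantifier theory $\mathbf A$ over $\mathcal S$ is a quantifier theory (resp. quantifier model, $2$-model) $\mathbf B$ over $\mathcal S\cup\{\emptyset\}$ whose restriction to $\mathcal S\setminus\{\emptyset\}$ equals that of $\mathbf A$. The modification $\mathbf A[Z]$ (for nonempty $Z\in\mathcal S$) agrees with $\mathbf A$ on $\mathcal S\setminus\{\emptyset\}$, has $\mathbf A[Z]_*(\emptyset)=\mathbf A_*(Z)$ and $\mathbf A[Z]^*(\emptyset)=\mathbf A^*(Z)$, and for $\sigma:X\to\mathbf A^*(Z)$ the element $t\sigma$ is the one given in $\mathbf A$. For a filter $I$ of $\mathbf A_*(Z)$, $\mathbf A[Z]/I$ is the modification that agrees with $\mathbf A[Z]$ except that its Boolean algebra at $\emptyset$ is the quotient $\mathbf A_*(Z)/I$, with $p\sigma$ replaced by its class. For an ultrafilter $I$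 the quotient is identified with $2$. Consistent and perfect. A subset of a Boolean algebra is consistent if it is contained in a proper filter (equivalently, finite meets of its elements are nonzero); an ultrafilter is a maximal consistent subset. For $\mathbf A$ locally finite and $Z\in\mathcal S$ infinite, an ultrafilter $I$ of $\mathbf A_*(Z)$ is perfect if for all $z\in Z$ and $q\in\mathbf A_*(Z)$ there is $d\in\mathbf A^*(Z)$ with $(\forall z.q)\vee\neg(q[d/z])\in I$. -}

module Defs where

open import Algebra.Lattice.Bundles using (BooleanAlgebra)
open import Algebra.Lattice.Morphism.Structures using (module LatticeMorphisms)
import Algebra.Lattice.Properties.BooleanAlgebra as BooleanAlgebraProperties
open import Axiom.ExcludedMiddle using (ExcludedMiddle)
open import Data.Bool.Base using (Bool; if_then_else_)
open import Data.Bool.Properties using (∨-∧-booleanAlgebra)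
open import Data.Empty using (⊥-elim)
import Data.Empty.Polymorphic as Polymorphic
open import Data.Fin.Base as Fin using (Fin)
import Data.Fin.Properties as Fin
open import Data.List.Base using (List)
open import Data.List.Membership.Propositional using () renaming (_∈_ to _∈ₗ_)
open import Data.Maybe.Base using (Maybe; just; nothing)
open import Data.Nat.Base as ℕ using (ℕ)
import Data.Nat.Properties as ℕ
open import Data.Product.Base using (Σ-syntax; ∃-syntax; _×_; _,_; proj₁; proj₂)
open import Function.Base using (_∘_)
open import Function.Bundles using (_↔_; Inverse; mk↔ₛ′)
open import Function.Definitions using (Injective; Surjective)
open import Level using (Level; _⊔_; suc; Lift; lift; lower)
open import Relation.Binary.Bundles using (Setoid; Poset)
open import Relation.Binary.PropositionalEquality.Core using (_≡_; _≢_; refl; sym; trans; cong)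
import Relation.Binary.Reasoning.Setoid as ≈-Reasoning
open import Relation.Nullary.Decidable.Core using (does)
open import Relation.Nullary.Negation.Core using (¬_)
open import Relation.Unary using (Pred; _∈_; _∉_; _⊆_)

private
  variable
    a b c ℓ ℓ₁ ℓ₂ : Level

-- All elements of NonEmpty X are definitionally equal, because those of
-- ¬ ¬ X are.

record NonEmpty (X : Set ℓ) : Set ℓ where
  constructor nonEmpty
  field
    notEmpty : ¬ ¬ X

inhabited : {X : Set ℓ} → X → NonEmpty X
inhabited x = nonEmpty (λ ¬x → ¬x x)

Infinite : Set ℓ → Set ℓ
Infinite X = ¬ (∃[ n ] (X ↔ Fin n))

infinite⇒nonEmpty : {X : Set ℓ} → Infinite X → NonEmpty X
infinite⇒nonEmpty inf = nonEmpty λ ¬x → inf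
  (0 , mk↔ₛ′ (λ x → ⊥-elim (¬x x)) (λ ()) (λ ()) (λ x → ⊥-elim (¬x x)))

ℕ-infinite : Infinite (Lift ℓ ℕ)
ℕ-infinite (n , iso) = ℕ.1+n≰n (Fin.injective⇒≤ {f = f} f-injective)
  where
  open Inverse iso
  f : Fin (ℕ.suc n) → Fin n
  f i = to (lift (Fin.toℕ i))
  f-injective : Injective _≡_ _≡_ f
  f-injective {i} {j} eq = Fin.toℕ-injective (cong lower
    (trans (sym (strictlyInverseʳ (lift (Fin.toℕ i))))
      (trans (cong from eq) (strictlyInverseʳ (lift (Fin.toℕ j))))))

record Collection c ℓ : Set (suc (c ⊔ ℓ)) where
  field
    Member      : Set c
    ⟦_⟧         : Member → Set ℓ
    hasInfinite : ∃[ X ] Infinite ⟦ X ⟧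

AllSets : ∀ ℓ → Collection (suc ℓ) ℓ
AllSets ℓ = record
  { Member      = Set ℓ
  ; ⟦_⟧         = λ X → X
  ; hasInfinite = Lift ℓ ℕ , ℕ-infinite
  }

_∖∅ : Collection c ℓ → Collection (c ⊔ ℓ) ℓ
𝒮 ∖∅ = record
  { Member      = Σ[ X ∈ Member ] NonEmpty ⟦ X ⟧
  ; ⟦_⟧         = λ X → ⟦ proj₁ X ⟧
  ; hasInfinite = let X , inf = hasInfinite in (X , infinite⇒nonEmpty inf) , inf
  }
  where open Collection 𝒮

-- 𝒮 ∪ {∅} is built as (𝒮 ∖ {∅}) ⊎ {∅}, with nothing standing for ∅, so
-- that whatever is specified at ∅ overrides what 𝒮 has there.

_∪∅ : Collection c ℓ → Collection (c ⊔ ℓ) ℓ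
_∪∅ {c} {ℓ} 𝒮 = record
  { Member      = Maybe (Collection.Member (𝒮 ∖∅))
  ; ⟦_⟧         = λ { nothing → Polymorphic.⊥ ; (just X) → Collection.⟦_⟧ (𝒮 ∖∅) X }
  ; hasInfinite = let X , inf = Collection.hasInfinite (𝒮 ∖∅) in just X , inf
  }

module _ (A : BooleanAlgebra a ℓ₁) (B : BooleanAlgebra b ℓ₂) where
  private
    module A = BooleanAlgebra A
    module B = BooleanAlgebra B
  open LatticeMorphisms A.rawLattice B.rawLattice using (IsLatticeHomomorphism)

  record IsBooleanHomomorphism (f : A.Carrier → B.Carrier) : Set (a ⊔ ℓ₁ ⊔ ℓ₂) where
    field
      isLatticeHomomorphism : IsLatticeHomomorphism f
      ¬-homo                : ∀ p → f (A.¬ p) B.≈ B.¬ f p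
      ⊤-homo                : f A.⊤ B.≈ B.⊤
      ⊥-homo                : f A.⊥ B.≈ B.⊥

  record IsBooleanIsomorphism (f : A.Carrier → B.Carrier) : Set (a ⊔ b ⊔ ℓ₁ ⊔ ℓ₂) where
    field
      isBooleanHomomorphism : IsBooleanHomomorphism f
      injective             : Injective A._≈_ B._≈_ f
      surjective            : Surjective A._≈_ B._≈_ f

module Order (B : BooleanAlgebra a ℓ) where
  open BooleanAlgebra B
  open Poset (BooleanAlgebraProperties.poset B) public using (_≤_)

  record IsInfimum {i} {I : Set i} (f : I → Carrier) (m : Carrier) : Set (a ⊔ ℓ ⊔ i) where
    field
      lowerBound : ∀ i → m ≤ f i
      greatest   : ∀ r → (∀ i → r ≤ f i) → r ≤ m

module Filters (B : BooleanAlgebra ℓ ℓ) where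
  open BooleanAlgebra B
  open Order B using (_≤_)

  record IsFilter (F : Pred Carrier ℓ) : Set ℓ where
    field
      ⊤-closed : ⊤ ∈ F
      ∧-closed : ∀ {p q} → p ∈ F → q ∈ F → p ∧ q ∈ F
      ↑-closed : ∀ {p q} → p ≤ q → p ∈ F → q ∈ F

  record IsProperFilter (F : Pred Carrier ℓ) : Set ℓ where
    field
      isFilter : IsFilter F
      proper   : ⊥ ∉ F

  Consistent : Pred Carrier ℓ → Set (suc ℓ)
  Consistent J = ∃[ F ] IsProperFilter F × J ⊆ F

  record IsUltrafilter (I : Pred Carrier ℓ) : Set (suc ℓ) where
    field
      consistent : Consistent I
      maximal    : ∀ K → Consistent K → I ⊆ K → K ⊆ I

    isFilter : IsFilter I
    isFilter = let F , F-proper , I⊆F = consistent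
                   open IsFilter (IsProperFilter.isFilter F-proper)
                   F⊆I = maximal F (F , F-proper , λ p∈F → p∈F) I⊆F
               in record
      { ⊤-closed = F⊆I ⊤-closed
      ; ∧-closed = λ p∈I q∈I → F⊆I (∧-closed (I⊆F p∈I) (I⊆F q∈I))
      ; ↑-closed = λ p≤q p∈I → F⊆I (↑-closed p≤q (I⊆F p∈I))
      }

-- The quotient of B by a filter F identifies p and q when they have the
-- same meet with some element of F.

module _ (B : BooleanAlgebra ℓ ℓ) {F : Pred (BooleanAlgebra.Carrier B) ℓ}
         (F-isFilter : Filters.IsFilter B F) where
  open BooleanAlgebra B hiding (refl; sym; trans) renaming (¬_ to infix 8 ∁_)
  open BooleanAlgebraProperties B using (∨-identityʳ; deMorgan₁; ¬-involutive)
  private module B = BooleanAlgebra B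
  open Filters B using (module IsFilter)
  open IsFilter F-isFilter
  open ≈-Reasoning setoid

  private
    _∼_ : Carrier → Carrier → Set ℓ
    p ∼ q = ∃[ r ] (r ∈ F × p ∧ r ≈ q ∧ r)

    ≈⇒∼ : ∀ {p q} → p ≈ q → p ∼ q
    ≈⇒∼ p≈q = ⊤ , ⊤-closed , ∧-cong p≈q (B.refl)

    widenˡ : ∀ {p q} r s → p ∧ r ≈ q ∧ r → p ∧ (r ∧ s) ≈ q ∧ (r ∧ s)
    widenˡ {p} {q} r s eq = begin
      p ∧ (r ∧ s)  ≈⟨ ∧-assoc p r s ⟨
      (p ∧ r) ∧ s  ≈⟨ ∧-congʳ eq ⟩
      (q ∧ r) ∧ s  ≈⟨ ∧-assoc q r s ⟩
      q ∧ (r ∧ s)  ∎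

    widenʳ : ∀ {p q} r s → p ∧ s ≈ q ∧ s → p ∧ (r ∧ s) ≈ q ∧ (r ∧ s)
    widenʳ {p} {q} r s eq = begin
      p ∧ (r ∧ s)  ≈⟨ ∧-congˡ (∧-comm r s) ⟩
      p ∧ (s ∧ r)  ≈⟨ widenˡ s r eq ⟩
      q ∧ (s ∧ r)  ≈⟨ ∧-congˡ (∧-comm s r) ⟩
      q ∧ (r ∧ s)  ∎

    ∼-trans : ∀ {p q u} → p ∼ q → q ∼ u → p ∼ u
    ∼-trans (r , r∈F , pr≈qr) (s , s∈F , qs≈us) =
      r ∧ s , ∧-closed r∈F s∈F ,
      B.trans (widenˡ r s pr≈qr) (widenʳ r s qs≈us)

    ∼-∨-cong : ∀ {p p′ q q′} → p ∼ p′ → q ∼ q′ → (p ∨ q) ∼ (p′ ∨ q′)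
    ∼-∨-cong {p} {p′} {q} {q′} (r , r∈F , eq₁) (s , s∈F , eq₂) =
      r ∧ s , ∧-closed r∈F s∈F , (begin
        (p ∨ q) ∧ (r ∧ s)                 ≈⟨ ∧-distribʳ-∨ (r ∧ s) p q ⟩
        (p ∧ (r ∧ s)) ∨ (q ∧ (r ∧ s))     ≈⟨ ∨-cong (widenˡ r s eq₁) (widenʳ r s eq₂) ⟩
        (p′ ∧ (r ∧ s)) ∨ (q′ ∧ (r ∧ s))   ≈⟨ ∧-distribʳ-∨ (r ∧ s) p′ q′ ⟨
        (p′ ∨ q′) ∧ (r ∧ s)               ∎)

    ¬-meet : ∀ p r → ∁ p ∧ r ≈ ∁ (p ∧ r) ∧ r
    ¬-meet p r = begin
      ∁ p ∧ r               ≈⟨ ∨-identityʳ (∁ p ∧ r) ⟨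
      (∁ p ∧ r) ∨ ⊥         ≈⟨ ∨-congˡ (∧-complementˡ r) ⟨
      (∁ p ∧ r) ∨ (∁ r ∧ r) ≈⟨ ∧-distribʳ-∨ r (∁ p) (∁ r) ⟨
      (∁ p ∨ ∁ r) ∧ r       ≈⟨ ∧-congʳ (deMorgan₁ p r) ⟨
      ∁ (p ∧ r) ∧ r         ∎

    ∼-¬-cong : ∀ {p q} → p ∼ q → (∁ p) ∼ (∁ q)
    ∼-¬-cong {p} {q} (r , r∈F , eq) = r , r∈F , (begin
      ∁ p ∧ r        ≈⟨ ¬-meet p r ⟩
      ∁ (p ∧ r) ∧ r  ≈⟨ ∧-congʳ (¬-cong eq) ⟩
      ∁ (q ∧ r) ∧ r  ≈⟨ ¬-meet q r ⟨
      ∁ q ∧ r        ∎)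

    ∼-∧-cong : ∀ {p p′ q q′} → p ∼ p′ → q ∼ q′ → (p ∧ q) ∼ (p′ ∧ q′)
    ∼-∧-cong p∼p′ q∼q′ = ∼-trans (≈⇒∼ (∧-as-∨ _ _))
      (∼-trans (∼-¬-cong (∼-∨-cong (∼-¬-cong p∼p′) (∼-¬-cong q∼q′)))
        (≈⇒∼ (B.sym (∧-as-∨ _ _))))
      where
      ∧-as-∨ : ∀ p q → p ∧ q ≈ ∁ (∁ p ∨ ∁ q)
      ∧-as-∨ p q = begin
        p ∧ q            ≈⟨ ¬-involutive (p ∧ q) ⟨
        ∁ ∁ (p ∧ q)      ≈⟨ ¬-cong (deMorgan₁ p q) ⟩
        ∁ (∁ p ∨ ∁ q)    ∎

  quotient : BooleanAlgebra ℓ ℓ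
  quotient = record
    { Carrier = Carrier
    ; _≈_ = _∼_
    ; _∨_ = _∨_
    ; _∧_ = _∧_
    ; ¬_  = ∁_
    ; ⊤   = ⊤
    ; ⊥   = ⊥
    ; isBooleanAlgebra = record
      { isDistributiveLattice = record
        { isLattice = record
          { isEquivalence = record
            { refl  = ≈⇒∼ (B.refl)
            ; sym   = λ (r , r∈F , eq) → r , r∈F , B.sym eq
            ; trans = ∼-trans
            }
          ; ∨-comm     = λ p q → ≈⇒∼ (∨-comm p q)
          ; ∨-assoc    = λ p q r → ≈⇒∼ (∨-assoc p q r)
          ; ∨-cong     = ∼-∨-cong
          ; ∧-comm     = λ p q → ≈⇒∼ (∧-comm p q)
          ; ∧-assoc    = λ p q r → ≈⇒∼ (∧-assoc p q r)
          ; ∧-cong     = ∼-∧-cong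
          ; absorptive = (λ p q → ≈⇒∼ (∨-absorbs-∧ p q)) , (λ p q → ≈⇒∼ (∧-absorbs-∨ p q))
          }
        ; ∨-distrib-∧ = (λ p q r → ≈⇒∼ (∨-distribˡ-∧ p q r)) , (λ p q r → ≈⇒∼ (∨-distribʳ-∧ p q r))
        ; ∧-distrib-∨ = (λ p q r → ≈⇒∼ (∧-distribˡ-∨ p q r)) , (λ p q r → ≈⇒∼ (∧-distribʳ-∨ p q r))
        }
      ; ∨-complement = (λ p → ≈⇒∼ (∨-complementˡ p)) , (λ p → ≈⇒∼ (∨-complementʳ p))
      ; ∧-complement = (λ p → ≈⇒∼ (∧-complementˡ p)) , (λ p → ≈⇒∼ (∧-complementʳ p))
      ; ¬-cong       = ∼-¬-cong
      }
    }

-- Terms X is 𝐀^*(X) and Formulas X is 𝐀_*(X).  The two sorts are kept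
-- apart, so an axiom or notion about t ∈ 𝐀(X) appears once for terms
-- (superscript t) and once for formulas.

record RawQuantifierTheory (𝒮 : Collection c ℓ) : Set (c ⊔ suc ℓ) where
  open Collection 𝒮
  infixl 9 _⟨_⟩ᵗ _⟨_⟩

  field
    Terms    : Member → Setoid ℓ ℓ
    Formulas : Member → BooleanAlgebra ℓ ℓ

  Term : Member → Set ℓ
  Term X = Setoid.Carrier (Terms X)

  Formula : Member → Set ℓ
  Formula X = BooleanAlgebra.Carrier (Formulas X)

  Substitution : Member → Member → Set ℓ
  Substitution X Y = ⟦ X ⟧ → Term Y

  field
    var    : ∀ {X} → Substitution X X
    _⟨_⟩ᵗ  : ∀ {X Y} ⦃ _ : NonEmpty ⟦ X ⟧ ⦄ → Term X → Substitution X Y → Term Y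
    _⟨_⟩   : ∀ {X Y} ⦃ _ : NonEmpty ⟦ X ⟧ ⦄ → Formula X → Substitution X Y → Formula Y
    forAll : ∀ {X} → ⟦ X ⟧ → Formula X → Formula X

  _≋_ : ∀ {X Y} → Substitution X Y → Substitution X Y → Set ℓ
  _≋_ {Y = Y} σ τ = ∀ x → Setoid._≈_ (Terms Y) (σ x) (τ x)

  infix 4 _≋_

  infixl 9 _⨾_
  _⨾_ : ∀ {X Y W} ⦃ _ : NonEmpty ⟦ Y ⟧ ⦄ →
        Substitution X Y → Substitution Y W → Substitution X W
  (σ ⨾ τ) x = σ x ⟨ τ ⟩ᵗ

  module _ {X : Member} ⦃ _ : NonEmpty ⟦ X ⟧ ⦄ where

    Supportsᵗ : Pred ⟦ X ⟧ ℓ → Term X → Set (c ⊔ ℓ)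
    Supportsᵗ U t = ∀ {Y} (σ τ : Substitution X Y) →
      (∀ {x} → x ∈ U → Setoid._≈_ (Terms Y) (σ x) (τ x)) →
      Setoid._≈_ (Terms Y) (t ⟨ σ ⟩ᵗ) (t ⟨ τ ⟩ᵗ)

    Supports : Pred ⟦ X ⟧ ℓ → Formula X → Set (c ⊔ ℓ)
    Supports U p = ∀ {Y} (σ τ : Substitution X Y) →
      (∀ {x} → x ∈ U → Setoid._≈_ (Terms Y) (σ x) (τ x)) →
      BooleanAlgebra._≈_ (Formulas Y) (p ⟨ σ ⟩) (p ⟨ τ ⟩)

    Closed : Formula X → Set (c ⊔ ℓ)
    Closed = Supports (λ _ → Polymorphic.⊥)

  Nontrivial : Set (c ⊔ ℓ)
  Nontrivial = ∃[ X ] Σ[ ne ∈ NonEmpty ⟦ X ⟧ ] ∃[ p ] ¬ Closed {X} ⦃ ne ⦄ p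

  -- Elements over the empty set are closed by definition, so only
  -- nonempty sets of variables impose a condition.

  record LocallyFinite : Set (c ⊔ ℓ) where
    field
      finiteSupportᵗ : ∀ {X} ⦃ _ : NonEmpty ⟦ X ⟧ ⦄ (t : Term X) →
                       Σ[ xs ∈ List ⟦ X ⟧ ] Supportsᵗ (_∈ₗ xs) t
      finiteSupport  : ∀ {X} ⦃ _ : NonEmpty ⟦ X ⟧ ⦄ (p : Formula X) →
                       Σ[ xs ∈ List ⟦ X ⟧ ] Supports (_∈ₗ xs) p

-- Changing a substitution at a single variable requires deciding equality
-- of variables in an arbitrary set, hence excluded middle.

module Update (em : ExcludedMiddle ℓ) {𝒮 : Collection c ℓ} (A : RawQuantifierTheory 𝒮) where
  open Collection 𝒮
  open RawQuantifierTheory A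

  _^[_/_] : ∀ {X Y} → Substitution X Y → Term Y → ⟦ X ⟧ → Substitution X Y
  (σ ^[ d / x ]) x′ = if does (em {x ≡ x′}) then d else σ x′

  [_/_] : ∀ {Y} → Term Y → ⟦ Y ⟧ → Substitution Y Y
  [ d / y ] = var ^[ d / y ]

record IsQuantifierTheory (em : ExcludedMiddle ℓ) {𝒮 : Collection c ℓ}
                          (A : RawQuantifierTheory 𝒮) : Set (c ⊔ ℓ) where
  open Collection 𝒮
  open RawQuantifierTheory A
  open Update em A
  private
    module T {X} = Setoid (Terms X)
    module F {X} = BooleanAlgebra (Formulas X)
    module O {X} = Order (Formulas X)

  field
    -- Equality in 𝐀^*(X) and 𝐀_*(X) is a setoid equality, and substitutions
    -- are compared pointwise, so the operations must be required to respect it.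

    ⟨⟩ᵗ-cong    : ∀ {X Y} ⦃ _ : NonEmpty ⟦ X ⟧ ⦄ {t u : Term X} {σ τ : Substitution X Y} →
                  t T.≈ u → σ ≋ τ → t ⟨ σ ⟩ᵗ T.≈ u ⟨ τ ⟩ᵗ
    ⟨⟩-cong     : ∀ {X Y} ⦃ _ : NonEmpty ⟦ X ⟧ ⦄ {p q : Formula X} {σ τ : Substitution X Y} →
                  p F.≈ q → σ ≋ τ → p ⟨ σ ⟩ F.≈ q ⟨ τ ⟩
    forAll-cong : ∀ {X} (x : ⟦ X ⟧) {p q : Formula X} → p F.≈ q → forAll x p F.≈ forAll x q

    P1ᵗ : ∀ {X} ⦃ _ : NonEmpty ⟦ X ⟧ ⦄ (t : Term X) → t ⟨ var ⟩ᵗ T.≈ t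
    P1  : ∀ {X} ⦃ _ : NonEmpty ⟦ X ⟧ ⦄ (p : Formula X) → p ⟨ var ⟩ F.≈ p
    P2ᵗ : ∀ {X Y W} ⦃ _ : NonEmpty ⟦ X ⟧ ⦄ ⦃ _ : NonEmpty ⟦ Y ⟧ ⦄
          (t : Term X) (σ : Substitution X Y) (τ : Substitution Y W) →
          t ⟨ σ ⟩ᵗ ⟨ τ ⟩ᵗ T.≈ t ⟨ σ ⨾ τ ⟩ᵗ
    P2  : ∀ {X Y W} ⦃ _ : NonEmpty ⟦ X ⟧ ⦄ ⦃ _ : NonEmpty ⟦ Y ⟧ ⦄
          (p : Formula X) (σ : Substitution X Y) (τ : Substitution Y W) →
          p ⟨ σ ⟩ ⟨ τ ⟩ F.≈ p ⟨ σ ⨾ τ ⟩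
    P3  : ∀ {X Y} ⦃ _ : NonEmpty ⟦ X ⟧ ⦄ (x : ⟦ X ⟧) (σ : Substitution X Y) →
          var x ⟨ σ ⟩ᵗ T.≈ σ x
    P4  : ∀ {X Y} ⦃ _ : NonEmpty ⟦ X ⟧ ⦄ (σ : Substitution X Y) →
          IsBooleanHomomorphism (Formulas X) (Formulas Y) (_⟨ σ ⟩)
    P5  : ∀ {X Y} ⦃ _ : NonEmpty ⟦ X ⟧ ⦄ ⦃ _ : NonEmpty ⟦ Y ⟧ ⦄
          (x : ⟦ X ⟧) (p : Formula X) (σ : Substitution X Y) (y z : ⟦ Y ⟧) →
          y ≢ z → σ ⨾ [ var z / y ] ≋ σ →
          forAll x p ⟨ σ ⟩ F.≈ forAll y (p ⟨ σ ^[ var y / x ] ⟩)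

    Q1  : ∀ {X} (x : ⟦ X ⟧) (p q : Formula X) →
          forAll x (p F.∧ q) F.≈ forAll x p F.∧ forAll x q
    Q2  : ∀ {X} (x : ⟦ X ⟧) (p : Formula X) → forAll x p O.≤ p
    Q3  : ∀ {X} ⦃ _ : NonEmpty ⟦ X ⟧ ⦄ (x y : ⟦ X ⟧) (p : Formula X) →
          y ≢ x → p ⟨ [ var y / x ] ⟩ F.≈ p → forAll x p F.≈ p

    nontrivial : Nontrivial

record QuantifierTheory (em : ExcludedMiddle ℓ) (𝒮 : Collection c ℓ) : Set (c ⊔ suc ℓ) where
  field
    raw                : RawQuantifierTheory 𝒮
    isQuantifierTheory : IsQuantifierTheory em raw

  open RawQuantifierTheory raw public
  open Update em raw public
  open IsQuantifierTheory isQuantifierTheory public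

-- Here o is a member of the collection playing the role of ∅.

record IsQuantifierModel (em : ExcludedMiddle ℓ) {𝒮 : Collection c ℓ}
                         (o : Collection.Member 𝒮)
                         (B : RawQuantifierTheory 𝒮) : Set (c ⊔ ℓ) where
  open Collection 𝒮
  open RawQuantifierTheory B
  open Update em B
  open BooleanAlgebra (Formulas o) using (_≉_; ⊤; ⊥)
  open Order (Formulas o) using (IsInfimum)

  field
    isQuantifierTheory : IsQuantifierTheory em B
    o-empty            : ¬ ⟦ o ⟧
    M1-terms           : NonEmpty (Term o)
    M1-formulas        : ⊥ ≉ ⊤
    M2                 : ∀ {X} ⦃ _ : NonEmpty ⟦ X ⟧ ⦄
                         (x : ⟦ X ⟧) (p : Formula X) (σ : Substitution X o) →
                         IsInfimum (λ (d : Term o) → p ⟨ σ ^[ d / x ] ⟩) (forAll x p ⟨ σ ⟩)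

record Is2Model (em : ExcludedMiddle ℓ) {𝒮 : Collection c ℓ}
                (o : Collection.Member 𝒮)
                (B : RawQuantifierTheory 𝒮) : Set (c ⊔ ℓ) where
  open RawQuantifierTheory B
  field
    isQuantifierModel : IsQuantifierModel em o B
    formulas≅2        : Σ[ f ∈ (Formula o → Bool) ]
                        IsBooleanIsomorphism (Formulas o) ∨-∧-booleanAlgebra f

module _ {𝒮 : Collection c ℓ} where
  open Collection 𝒮

  private
    module 𝒮∪∅ = Collection (𝒮 ∪∅)

  restrict : RawQuantifierTheory 𝒮 → RawQuantifierTheory (𝒮 ∖∅)
  restrict A = record
    { Terms    = λ X → Terms (proj₁ X)
    ; Formulas = λ X → Formulas (proj₁ X)
    ; var      = var
    ; _⟨_⟩ᵗ    = _⟨_⟩ᵗ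
    ; _⟨_⟩     = _⟨_⟩
    ; forAll   = forAll
    }
    where open RawQuantifierTheory A

  restrict∪ : RawQuantifierTheory (𝒮 ∪∅) → RawQuantifierTheory (𝒮 ∖∅)
  restrict∪ B = record
    { Terms    = λ X → Terms (just X)
    ; Formulas = λ X → Formulas (just X)
    ; var      = λ {X} → var {just X}
    ; _⟨_⟩ᵗ    = λ {X} {Y} → _⟨_⟩ᵗ {just X} {just Y}
    ; _⟨_⟩     = λ {X} {Y} → _⟨_⟩ {just X} {just Y}
    ; forAll   = λ {X} → forAll {just X}
    }
    where open RawQuantifierTheory B

  record Is2ModelOf (em : ExcludedMiddle ℓ) (A : RawQuantifierTheory 𝒮)
                    (B : RawQuantifierTheory (𝒮 ∪∅)) : Set (c ⊔ suc ℓ) where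
    field
      isModification : restrict∪ B ≡ restrict A
      is2Model       : Is2Model em nothing B

  -- 𝐀[Z]: what the modification has at ∅ is what 𝐀 has at Z.

  infixl 10 _at_
  _at_ : RawQuantifierTheory 𝒮 → Member → RawQuantifierTheory (𝒮 ∪∅)
  A at Z = record
    { Terms    = λ X → Terms (⌊ X ⌋)
    ; Formulas = λ X → Formulas (⌊ X ⌋)
    ; var      = λ { {nothing} () ; {just X} → var }
    ; _⟨_⟩ᵗ    = λ { {nothing} ⦃ ne ⦄ → absurd ne ; {just X} {Y} → _⟨_⟩ᵗ {proj₁ X} {⌊ Y ⌋} }
    ; _⟨_⟩     = λ { {nothing} ⦃ ne ⦄ → absurd ne ; {just X} {Y} → _⟨_⟩ {proj₁ X} {⌊ Y ⌋} }
    ; forAll   = λ { {nothing} () ; {just X} → forAll }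
    }
    where
    open RawQuantifierTheory A
    ⌊_⌋ : 𝒮∪∅.Member → Member
    ⌊ nothing ⌋ = Z
    ⌊ just X  ⌋ = proj₁ X
    absurd : ∀ {w} {W : Set w} → NonEmpty (Polymorphic.⊥ {ℓ}) → W
    absurd ne = ⊥-elim (NonEmpty.notEmpty ne λ ())

  -- Replaces the Boolean algebra at ∅ by its quotient; a class is
  -- represented by any of its elements, so p ⟨ σ ⟩ is left unchanged.

  infixl 9 _mod_
  _mod_ : (B : RawQuantifierTheory (𝒮 ∪∅)) →
          let B∅ = RawQuantifierTheory.Formulas B nothing in
          {I : Pred (BooleanAlgebra.Carrier B∅) ℓ} → Filters.IsFilter B∅ I →
          RawQuantifierTheory (𝒮 ∪∅)
  B mod I-isFilter = record
    { Terms    = Terms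
    ; Formulas = λ { nothing → quotient (Formulas nothing) I-isFilter ; (just X) → Formulas (just X) }
    ; var      = var
    ; _⟨_⟩ᵗ    = _⟨_⟩ᵗ
    ; _⟨_⟩     = λ { {nothing} ⦃ ne ⦄ → ⊥-elim (NonEmpty.notEmpty ne λ ())
                   ; {just X} {nothing} → _⟨_⟩ {just X} {nothing}
                   ; {just X} {just Y} → _⟨_⟩ {just X} {just Y} }
    ; forAll   = λ { {nothing} () ; {just X} → forAll {just X} }
    }
    where open RawQuantifierTheory B

module _ {em : ExcludedMiddle ℓ} (A : QuantifierTheory em (AllSets ℓ)) where
  open QuantifierTheory A

  record IsPerfect (Z : Set ℓ) (I : Pred (Formula Z) ℓ) : Set (suc ℓ) where
    open BooleanAlgebra (Formulas Z) using (_∨_) renaming (¬_ to neg_)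
    field
      isUltrafilter : Filters.IsUltrafilter (Formulas Z) I
      witness       : ∀ (z : Z) (q : Formula Z) → ∃[ d ]
                      forAll z q ∨ neg (_⟨_⟩ ⦃ inhabited z ⦄ q [ d / z ]) ∈ I

    open Filters.IsUltrafilter isUltrafilter public

  -- A set X⁺ containing X is given by an injection X → X⁺, the inclusion.

  record IsPerfectExtension {X : Set ℓ} (X-infinite : Infinite X) (J : Pred (Formula X) ℓ)
                            (X⁺ : Set ℓ) (κ : X → X⁺) (I : Pred (Formula X⁺) ℓ) :
                            Set (suc ℓ) where
    field
      infinite    : Infinite X⁺
      κ-injective : Injective _≡_ _≡_ κ
      isPerfect   : IsPerfect X⁺ I
      J⊆I         : ∀ {p} → p ∈ J → _⟨_⟩ ⦃ infinite⇒nonEmpty X-infinite ⦄ p (var ∘ κ) ∈ I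

    open IsPerfect isPerfect public using (isFilter)

{-# OPTIONS --safe #-}
module Submission where

-- (a) X⁺ adds to X a Henkin constant c for each pair of a variable z and a
-- formula q over X⁺, and the Henkin axioms ∀z.q ∨ ¬q[c/z] are consistent with
-- J: of finitely many of them, take one whose constant does not occur in the
-- others; if the remaining conjunction r refuted it, then r ≤ ¬∀z.q and
-- r ≤ q[c/z], whence r = ∀c.r ≤ ∀c.(q[c/z]) = ∀z.q and r = 0.  An ultrafilter
-- containing the axioms is perfect.
-- (b) Membership in I turns the infimum condition into: if pσ^{d/x} ∈ I for
-- all d, then (∀x.p)σ ∈ I.  By local finiteness σ may be taken to avoid a
-- variable y, so that (∀x.p)σ = ∀y.(pσ^{y/x}), and perfectness applies.

open import Defs
open import Algebra.Lattice.Bundles using (BooleanAlgebra)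
open import Algebra.Lattice.Morphism.Structures using (module LatticeMorphisms)
import Algebra.Lattice.Properties.BooleanAlgebra as BooleanAlgebraProperties
open import Axiom.ExcludedMiddle using (ExcludedMiddle)
open import Axiom.Extensionality.Propositional using (Extensionality)
open import Data.Bool.Base using (Bool; true; false; not) renaming (_∧_ to _and_; _∨_ to _or_)
open import Data.Bool.Properties using (∨-zeroʳ; ∨-∧-booleanAlgebra)
open import Data.Empty using (⊥-elim)
import Data.Empty.Polymorphic as Polymorphic
import Data.Fin.Base as Fin
import Data.Fin.Properties as Fin
open import Data.List.Base
  using (List; []; _∷_; _++_; concatMap; deduplicate; filter; foldr; length; lookup; map)
open import Data.List.Membership.Propositional using (lose) renaming (_∈_ to _∈ₗ_; _∉_ to _∉ₗ_)
open import Data.List.Membership.Propositional.Properties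
  using (∈-++⁺ˡ; ∈-++⁺ʳ; ∈-concatMap⁺; ∈-deduplicate⁺; ∈-filter⁺; ∈-filter⁻; ∈-lookup; ∈-map⁺; ∈-map⁻)
open import Data.List.Properties using (filter-notAll)
open import Data.List.Relation.Unary.All as All using (All; []; _∷_)
import Data.List.Relation.Unary.All.Properties as All
open import Data.List.Relation.Unary.AllPairs using (_∷_)
open import Data.List.Relation.Unary.Any using (here; there; index)
open import Data.List.Relation.Unary.Any.Properties using (lookup-index)
open import Data.List.Relation.Unary.Unique.DecPropositional.Properties using (deduplicate-!)
open import Data.List.Relation.Unary.Unique.Propositional using (Unique)
open import Data.Maybe.Base using (Maybe; just; nothing)
open import Data.Nat.Base as ℕ using (ℕ; zero; suc)
open import Data.Nat.Induction using (<-wellFounded)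
import Data.Nat.Properties as ℕ
open import Data.List.Extrema ℕ.≤-totalOrder
  using (argmax; argmax-sel; f[⊥]≤f[argmax]; f[xs]≤f[argmax])
open import Data.Product.Base using (Σ-syntax; ∃-syntax; _×_; _,_; proj₁; proj₂)
open import Data.Sum.Base using (_⊎_; inj₁; inj₂; [_,_]′)
import Data.Unit.Polymorphic.Base as Unit
open import Function.Base using (_∘_; id; it)
open import Function.Bundles using (Inverse; mk↔ₛ′)
open import Function.Definitions using (Injective)
open import Induction.WellFounded using (Acc; acc)
open import Level using (Lift; lift; lower)
open import Relation.Binary.Bundles using (Setoid)
open import Relation.Binary.Definitions using (DecidableEquality)
open import Relation.Binary.Lattice.Bundles using (Lattice)
open import Relation.Binary.PropositionalEquality
  using (_≡_; _≢_; refl; sym; trans; cong; subst)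
import Relation.Binary.Reasoning.PartialOrder as ≤-Reasoning
import Relation.Binary.Reasoning.Setoid as ≈-Reasoning
open import Relation.Nullary.Decidable using (Dec; yes; no; does; dec-true; dec-false; decidable-stable)
open import Relation.Nullary.Negation using (¬_; contradiction)
open import Relation.Unary using (Pred; _∈_; _∉_; _⊆_)

-- Teichmüller–Tukey lemma

-- Subsets are Bool-valued, so that they form a small type, extensional by
-- function extensionality, and are closed under arbitrary unions by excluded
-- middle.  Since em returns a witness, it also provides the choices.

module Tukey (em : ∀ {a} → ExcludedMiddle a) (ext : ∀ {a b} → Extensionality a b)
             {ℓ} {C : Set ℓ} (Good : Pred (List C) ℓ) (S₀ : C → Bool) where

  Subset : Set ℓ
  Subset = C → Bool

  infix 4 _∈ˢ_ _⊑_

  _∈ˢ_ : C → Subset → Set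
  x ∈ˢ S = S x ≡ true

  _⊑_ : Subset → Subset → Set ℓ
  S ⊑ S′ = ∀ {x} → x ∈ˢ S → x ∈ˢ S′

  -- Mutual inclusion has to give propositional equality, since `compare` and `extreme` transport
  -- `next`, which chooses its new element by `em`, along it.
  ⊑-antisym : ∀ {S S′} → S ⊑ S′ → S′ ⊑ S → S ≡ S′
  ⊑-antisym {S} {S′} S⊑S′ S′⊑S = ext λ x → equal (S x) (S′ x) S⊑S′ S′⊑S
    where
    equal : ∀ a b → (a ≡ true → b ≡ true) → (b ≡ true → a ≡ true) → a ≡ b
    equal true  b     f g = sym (f refl)
    equal false true  f g = g refl
    equal false false f g = refl

  does-elim : ∀ {a} {P : Set a} → does (em {P = P}) ≡ true → P
  does-elim {P = P} eq with em {P = P}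
  ... | yes p = p
  does-elim () | no _

  insert : C → Subset → Subset
  insert p S x = S x or does (em {P = x ≡ p})

  ⊑-insert : ∀ p S → S ⊑ insert p S
  ⊑-insert p S {x} x∈S rewrite x∈S = refl

  ∈-insert : ∀ p S → p ∈ˢ insert p S
  ∈-insert p S rewrite dec-true (em {P = p ≡ p}) refl = ∨-zeroʳ (S p)

  insert-elim : ∀ p S {x} → x ∈ˢ insert p S → x ∈ˢ S ⊎ x ≡ p
  insert-elim p S {x} eq with S x | em {P = x ≡ p}
  ... | true  | _       = inj₁ refl
  ... | false | yes x≡p = inj₂ x≡p
  insert-elim p S () | false | no _

  -- A condition of finite character: only finite lists are tested, which is what carries it over to
  -- unions of chains.
  Admissible : Subset → Set ℓ
  Admissible S = ∀ L → All (_∈ˢ S) L → Good L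

  Extendable : Subset → Set ℓ
  Extendable S = ∃[ p ] ¬ p ∈ˢ S × Admissible (insert p S)

  -- The decision is an argument, so that `fixed` can split on it inside the type of `next⊑M`.
  extend : ∀ {S} → Dec (Extendable S) → Subset
  extend {S} (yes (p , _)) = insert p S
  extend {S} (no _)        = S

  next : Subset → Subset
  next S = extend (em {P = Extendable S})

  ⊑-next : ∀ S → S ⊑ next S
  ⊑-next S with em {P = Extendable S}
  ... | yes (p , _) = ⊑-insert p S
  ... | no _        = id

  -- S₀ is joined to every union, so the empty family yields the bottom of `Tower`.
  ⋃ : (Subset → Bool) → Subset
  ⋃ D x = does (em {P = x ∈ˢ S₀ ⊎ ∃[ S ] D S ≡ true × x ∈ˢ S})

  S₀⊑⋃ : ∀ D → S₀ ⊑ ⋃ D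
  S₀⊑⋃ D = dec-true em ∘ inj₁

  ⊑⋃ : ∀ D {S} → D S ≡ true → S ⊑ ⋃ D
  ⊑⋃ D S∈D x∈S = dec-true em (inj₂ (_ , S∈D , x∈S))

  ⋃⊑ : ∀ D {S} → S₀ ⊑ S → (∀ {S′} → D S′ ≡ true → S′ ⊑ S) → ⋃ D ⊑ S
  ⋃⊑ D S₀⊑S D⊑S x∈⋃ with does-elim x∈⋃
  ... | inj₁ x∈S₀              = S₀⊑S x∈S₀
  ... | inj₂ (_ , S′∈D , x∈S′) = D⊑S S′∈D x∈S′

  -- As in Bourbaki–Witt, Tower is a chain under ⊑, so the union of its members
  -- is its greatest member and is fixed by next.
  data Tower : Subset → Set ℓ where
    step  : ∀ {S} → Tower S → Tower (next S)
    union : ∀ D → (∀ {S} → D S ≡ true → Tower S) → Tower (⋃ D)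

  S₀⊑ : ∀ {S} → Tower S → S₀ ⊑ S
  S₀⊑ (step {S} t)  = ⊑-next S ∘ S₀⊑ t
  S₀⊑ (union D _)   = S₀⊑⋃ D

  -- The extreme points of the Bourbaki-Witt argument. Every member of `Tower` turns out to be one,
  -- which makes it a chain.
  Extreme : Subset → Set ℓ
  Extreme S = ∀ {S′} → Tower S′ → S′ ⊑ S → ¬ S ⊑ S′ → next S′ ⊑ S

  -- Induction on S′. At a successor, extremeness of S settles strict inclusion, and S = S′ makes
  -- the successors equal. At a union, either some member already contains `next S` or all of them
  -- lie below S.
  compare : ∀ {S S′} → Tower S → Extreme S → Tower S′ → S′ ⊑ S ⊎ next S ⊑ S′
  compare {S} t e (step {S′} t′) with compare t e t′ | em {P = S ⊑ S′}
  ... | inj₂ S⁺⊑S′ | _        = inj₂ (⊑-next S′ ∘ S⁺⊑S′)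
  ... | inj₁ S′⊑S  | no S⋢S′  = inj₁ (e t′ S′⊑S S⋢S′)
  ... | inj₁ S′⊑S  | yes S⊑S′ = inj₂ (subst (λ R → next S ⊑ next R) (⊑-antisym S⊑S′ S′⊑S) id)
  compare {S} t e (union D ts) with em {P = ∃[ S′ ] D S′ ≡ true × next S ⊑ S′}
  ... | yes (_ , S′∈D , S⁺⊑S′) = inj₂ (⊑⋃ D S′∈D ∘ S⁺⊑S′)
  ... | no none = inj₁ (⋃⊑ D (S₀⊑ t) below)
    where
    below : ∀ {S′} → D S′ ≡ true → S′ ⊑ S
    below S′∈D with compare t e (ts S′∈D)
    ... | inj₁ S′⊑S  = S′⊑S
    ... | inj₂ S⁺⊑S′ = contradiction (_ , S′∈D , λ {x} → S⁺⊑S′ {x}) none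

  -- Induction on S, comparing S′ with a predecessor of S. A union not included in S′ has a member
  -- not included in S′, and that member is extreme by induction.
  extreme : ∀ {S} → Tower S → Extreme S
  extreme (step {S} t) {S′} t′ S′⊑S⁺ S⁺⋢S′ with compare t (extreme t) t′ | em {P = S ⊑ S′}
  ... | inj₂ S⁺⊑S′ | _        = contradiction (λ {x} → S⁺⊑S′ {x}) S⁺⋢S′
  ... | inj₁ S′⊑S  | no S⋢S′  = ⊑-next S ∘ extreme t t′ S′⊑S S⋢S′
  ... | inj₁ S′⊑S  | yes S⊑S′ = subst (λ R → next R ⊑ next S) (⊑-antisym S⊑S′ S′⊑S) id
  extreme (union D ts) {S′} t′ S′⊑⋃ ⋃⋢S′ with em {P = ∃[ S ] D S ≡ true × ¬ S ⊑ S′}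
  ... | no none = contradiction
          (λ {x} → ⋃⊑ D {S′} (S₀⊑ t′)
            (λ S∈D → decidable-stable em λ S⋢S′ → none (_ , S∈D , S⋢S′)) {x})
          ⋃⋢S′
  ... | yes (S , S∈D , S⋢S′) with compare (ts S∈D) (extreme (ts S∈D)) t′
  ...   | inj₁ S′⊑S  = ⊑⋃ D S∈D ∘ extreme (ts S∈D) t′ S′⊑S S⋢S′
  ...   | inj₂ S⁺⊑S′ = contradiction (λ {x} → S⁺⊑S′ {x} ∘ ⊑-next S) S⋢S′

  chain : ∀ {S S′} → Tower S → Tower S′ → S′ ⊑ S ⊎ S ⊑ S′
  chain {S} t t′ with compare t (extreme t) t′
  ... | inj₁ S′⊑S  = inj₁ S′⊑S
  ... | inj₂ S⁺⊑S′ = inj₂ (S⁺⊑S′ ∘ ⊑-next S)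

  module _ (S₀-admissible : Admissible S₀) where

    -- The finitely many entries of a list drawn from a union lie together in S₀ or, by `chain`, in
    -- a single member of the family.
    admissible : ∀ {S} → Tower S → Admissible S
    admissible (step {S} t) with em {P = Extendable S}
    ... | yes (_ , _ , adm) = adm
    ... | no _              = admissible t
    admissible (union D ts) L L⊆⋃ with covered L L⊆⋃
      where
      covered : ∀ L → All (_∈ˢ ⋃ D) L →
                All (_∈ˢ S₀) L ⊎ ∃[ S ] D S ≡ true × All (_∈ˢ S) L
      covered []      []         = inj₁ []
      covered (x ∷ L) (x∈ ∷ L⊆) with does-elim x∈ | covered L L⊆
      ... | inj₁ x∈S₀             | inj₁ L⊆S₀            = inj₁ (x∈S₀ ∷ L⊆S₀)
      ... | inj₁ x∈S₀             | inj₂ (S , S∈D , L⊆S) = inj₂ (S , S∈D , S₀⊑ (ts S∈D) x∈S₀ ∷ L⊆S)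
      ... | inj₂ (S , S∈D , x∈S)  | inj₁ L⊆S₀            =
              inj₂ (S , S∈D , x∈S ∷ All.map (S₀⊑ (ts S∈D)) L⊆S₀)
      ... | inj₂ (S , S∈D , x∈S)  | inj₂ (S′ , S′∈D , L⊆S′) with chain (ts S∈D) (ts S′∈D)
      ...   | inj₁ S′⊑S = inj₂ (S , S∈D , x∈S ∷ All.map S′⊑S L⊆S′)
      ...   | inj₂ S⊑S′ = inj₂ (S′ , S′∈D , S⊑S′ x∈S ∷ L⊆S′)
    ... | inj₁ L⊆S₀             = S₀-admissible L L⊆S₀
    ... | inj₂ (_ , S∈D , L⊆S)  = admissible (ts S∈D) L L⊆S

    tukey : Σ[ M ∈ Subset ] S₀ ⊑ M × Admissible M ×
              (∀ p → Admissible (insert p M) → p ∈ˢ M)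
    tukey = M , S₀⊑ M-tower , admissible M-tower , maximal
      where
      All-towers : Subset → Bool
      All-towers S = does (em {P = Tower S})
      M = ⋃ All-towers
      M-tower : Tower M
      M-tower = union All-towers does-elim
      next⊑M : next M ⊑ M
      next⊑M = ⊑⋃ All-towers (dec-true em (step M-tower))
      maximal : ∀ p → Admissible (insert p M) → p ∈ˢ M
      maximal p adm = decidable-stable em λ p∉M → fixed (em {P = Extendable M}) next⊑M
          (p , p∉M , adm)
        where
        fixed : (d : Dec (Extendable M)) → extend d ⊑ M → ¬ Extendable M
        -- An element newly inserted by `next` would already belong to M, as M contains `next M`.
        fixed (yes (q , q∉M , _)) ext⊑M _ = q∉M (ext⊑M (∈-insert q M))
        fixed (no ¬e)             _       = ¬e

-- The order of a Boolean algebra and finite meets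

module BooleanOrder {a ℓ} (B : BooleanAlgebra a ℓ) where
  open BooleanAlgebra B hiding (refl; sym; trans)
    renaming (¬_ to infix 8 ∁_)
  private module B = BooleanAlgebra B
  open BooleanAlgebraProperties B
  open Order B using (_≤_)
  open Lattice ∨-∧-orderTheoreticLattice public
    using (x≤x∨y; y≤x∨y; ∨-least; x∧y≤x; x∧y≤y; ∧-greatest)
    renaming (refl to ≤-refl; trans to ≤-trans; antisym to ≤-antisym; reflexive to ≤-reflexive)
  open ≈-Reasoning setoid

  ≤⊤ : ∀ p → p ≤ ⊤
  ≤⊤ p = B.sym (∧-identityʳ p)

  ⊥≤ : ∀ p → ⊥ ≤ p
  ⊥≤ p = B.sym (∧-zeroˡ p)

  ≤⊥⇒≈⊥ : ∀ {p} → p ≤ ⊥ → p ≈ ⊥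
  ≤⊥⇒≈⊥ {p} p≤⊥ = ≤-antisym p≤⊥ (⊥≤ p)

  ∧-mono : ∀ {p p′ q q′} → p ≤ p′ → q ≤ q′ → p ∧ q ≤ p′ ∧ q′
  ∧-mono p≤p′ q≤q′ =
    ∧-greatest (≤-trans (x∧y≤x _ _) p≤p′) (≤-trans (x∧y≤y _ _) q≤q′)

  ∧≈⊥⇒≤∁ : ∀ {p q} → p ∧ q ≈ ⊥ → p ≤ ∁ q
  ∧≈⊥⇒≤∁ {p} {q} eq = begin
    p                    ≈⟨ ∧-identityʳ p ⟨
    p ∧ ⊤                ≈⟨ ∧-congˡ (∨-complementʳ q) ⟨
    p ∧ (q ∨ ∁ q)        ≈⟨ ∧-distribˡ-∨ p q (∁ q) ⟩
    (p ∧ q) ∨ (p ∧ ∁ q)  ≈⟨ ∨-congʳ eq ⟩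
    ⊥ ∨ (p ∧ ∁ q)        ≈⟨ ∨-identityˡ _ ⟩
    p ∧ ∁ q              ∎

  ∧∁≈⊥⇒≤ : ∀ {p q} → p ∧ ∁ q ≈ ⊥ → p ≤ q
  ∧∁≈⊥⇒≤ {p} {q} eq = ≤-trans (∧≈⊥⇒≤∁ eq) (≤-reflexive (¬-involutive q))

  disjunctive-syllogism : ∀ {p q r} → q ∧ r ≈ ⊥ → (p ∨ q) ∧ r ≤ p
  disjunctive-syllogism {p} {q} {r} qr≈⊥ = ≤-trans (≤-reflexive (∧-distribʳ-∨ r p q))
    (∨-least (x∧y≤x p r) (≤-trans (≤-reflexive qr≈⊥) (⊥≤ p)))

  ⋀ : List Carrier → Carrier
  ⋀ = foldr _∧_ ⊤

  ⋀-lower : ∀ {p L} → p ∈ₗ L → ⋀ L ≤ p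
  ⋀-lower (here refl)  = x∧y≤x _ _
  ⋀-lower (there p∈L) = ≤-trans (x∧y≤y _ _) (⋀-lower p∈L)

  ⋀-greatest : ∀ {r L} → All (r ≤_) L → r ≤ ⋀ L
  ⋀-greatest []         = ≤⊤ _
  ⋀-greatest (r≤p ∷ r≤) = ∧-greatest r≤p (⋀-greatest r≤)

-- Ultrafilters and the ultrafilter lemma

module Ultrafilters (em : ∀ {a} → ExcludedMiddle a) {ℓ} (B : BooleanAlgebra ℓ ℓ) where
  open BooleanAlgebra B hiding (refl; sym; trans)
    renaming (¬_ to infix 8 ∁_)
  open BooleanOrder B
  open Order B using (_≤_)
  open Filters B

  ⋀-closed : ∀ {F} → IsFilter F → ∀ {L} → All (_∈ F) L → ⋀ L ∈ F
  ⋀-closed F-filter []         = IsFilter.⊤-closed F-filter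
  ⋀-closed F-filter (p∈F ∷ L⊆F) = IsFilter.∧-closed F-filter p∈F (⋀-closed F-filter L⊆F)

  module _ {I : Pred Carrier ℓ} (I-ultra : IsUltrafilter I) where
    open IsUltrafilter I-ultra
    open IsFilter isFilter

    ⊥∉ : ⊥ ∉ I
    ⊥∉ ⊥∈I = let _ , F-proper , I⊆F = consistent in IsProperFilter.proper F-proper (I⊆F ⊥∈I)

    ∁-∉ : ∀ {p} → p ∈ I → ∁ p ∉ I
    ∁-∉ {p} p∈I ∁p∈I =
      ⊥∉ (↑-closed (≤-reflexive (∧-complementʳ p)) (∧-closed p∈I ∁p∈I))

    -- If the complement were missing too, the filter `K` generated by I and p would be proper, and
    -- maximality would put p into I.
    ∉⇒∁-∈ : ∀ {p} → p ∉ I → ∁ p ∈ I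
    ∉⇒∁-∈ {p} p∉I = decidable-stable em λ ∁p∉I →
      p∉I (maximal K (K , K-proper ∁p∉I , id) I⊆K
        (⊤ , ⊤-closed , x∧y≤y ⊤ p))
      where
      K : Pred Carrier ℓ
      K q = ∃[ r ] r ∈ I × r ∧ p ≤ q
      I⊆K : I ⊆ K
      I⊆K {q} q∈I = q , q∈I , x∧y≤x q p
      K-proper : ∁ p ∉ I → IsProperFilter K
      K-proper ∁p∉I = record
        { isFilter = record
          { ⊤-closed = I⊆K ⊤-closed
          ; ∧-closed = λ (r , r∈I , rp≤q) (s , s∈I , sp≤u) →
              r ∧ s , ∧-closed r∈I s∈I ,
              ∧-greatest (≤-trans (∧-mono (x∧y≤x r s) ≤-refl) rp≤q)
                         (≤-trans (∧-mono (x∧y≤y r s) ≤-refl) sp≤u)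
          ; ↑-closed = λ q≤u (r , r∈I , rp≤q) → r , r∈I , ≤-trans rp≤q q≤u
          }
        ; proper = λ (r , r∈I , rp≤⊥) → ∁p∉I (↑-closed (∧≈⊥⇒≤∁ (≤⊥⇒≈⊥ rp≤⊥)) r∈I)
        }

  -- Nonvanishing of finite meets is of finite character, so `tukey` provides a maximal subset with
  -- this property; it is an ultrafilter.
  ultrafilter-lemma : (∀ {a b} → Extensionality a b) → (G : Pred Carrier ℓ) →
    (∀ L → All (_∈ G) L → ⋀ L ≉ ⊥) → Σ[ I ∈ Pred Carrier ℓ ] IsUltrafilter I × G ⊆ I
  ultrafilter-lemma ext G G-fip = I , I-ultra , λ p∈G → lift (G⊑M (dec-true em p∈G))
    where
    open Tukey em ext (λ L → ⋀ L ≉ ⊥) (λ p → does (em {P = p ∈ G}))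
    maximalSubset = tukey λ L L⊆ → G-fip L (All.map does-elim L⊆)
    M = proj₁ maximalSubset
    G⊑M = proj₁ (proj₂ maximalSubset)
    M-admissible = proj₁ (proj₂ (proj₂ maximalSubset))
    M-maximal = proj₂ (proj₂ (proj₂ maximalSubset))
    I : Pred Carrier ℓ
    I p = Lift ℓ (p ∈ˢ M)
    -- The filter generated by M, which shows that I is consistent.
    F : Pred Carrier ℓ
    F p = ∃[ L ] All (_∈ˢ M) L × ⋀ L ≤ p
    F-proper : IsProperFilter F
    F-proper = record
      { isFilter = record
        { ⊤-closed = [] , [] , ≤-refl
        ; ∧-closed = λ (L , L⊆M , L≤p) (L′ , L′⊆M , L′≤q) →
            L ++ L′ , All.++⁺ L⊆M L′⊆M , ∧-greatest
              (≤-trans (⋀-greatest {L = L} (All.tabulate (⋀-lower ∘ ∈-++⁺ˡ))) L≤p)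
              (≤-trans (⋀-greatest {L = L′} (All.tabulate (⋀-lower ∘ ∈-++⁺ʳ L))) L′≤q)
        ; ↑-closed = λ p≤q (L , L⊆M , L≤p) → L , L⊆M , ≤-trans L≤p p≤q
        }
      ; proper = λ (L , L⊆M , L≤⊥) → M-admissible L L⊆M (≤⊥⇒≈⊥ L≤⊥)
      }
    I-ultra : IsUltrafilter I
    I-ultra = record
      { consistent = F , F-proper , λ {p} (lift p∈M) → p ∷ [] , p∈M ∷ [] , x∧y≤x p ⊤
      -- A proper filter that contains I and p contains M with p inserted, so no finite meet of the
      -- latter vanishes and M already contains p.
      ; maximal = λ K (E , E-proper , K⊆E) I⊆K {p} p∈K → lift (M-maximal p λ L L⊆ L≈⊥ →
          let open IsProperFilter E-proper
              inE : ∀ {q} → q ∈ˢ insert p M → q ∈ E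
              inE q∈ = [ (λ q∈M → K⊆E (I⊆K (lift q∈M))) , (λ { refl → K⊆E p∈K }) ]′
                         (insert-elim p M q∈)
          in proper (IsFilter.↑-closed isFilter (≤-reflexive L≈⊥)
               (⋀-closed isFilter (All.map inE L⊆))))
      }

-- Substitution and quantification in a theory over all sets

element : ∀ {ℓ} → ExcludedMiddle ℓ → {X : Set ℓ} → NonEmpty X → X
element em ne = decidable-stable em (NonEmpty.notEmpty ne)

module Theory (em : ∀ {a} → ExcludedMiddle a) {ℓ} (A : QuantifierTheory em (AllSets ℓ)) where
  open QuantifierTheory A
  module T {X} = Setoid (Terms X)
  module F {X} = BooleanAlgebra (Formulas X)
  module O {X} = Order (Formulas X)

  private
    variable
      X Y W : Set ℓ

  update-same : (σ : Substitution X Y) (d : Term Y) (x : X) → (σ ^[ d / x ]) x ≡ d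
  update-same σ d x with em {P = x ≡ x}
  ... | yes _   = refl
  ... | no x≢x = contradiction refl x≢x

  update-other : (σ : Substitution X Y) (d : Term Y) {x x′ : X} →
                 x ≢ x′ → (σ ^[ d / x ]) x′ ≡ σ x′
  update-other σ d {x} {x′} x≢x′ with em {P = x ≡ x′}
  ... | yes x≡x′ = contradiction x≡x′ x≢x′
  ... | no _     = refl

  -- Stated at one variable rather than with `≋`, so that it applies to substitutions that agree
  -- only on a support.
  update-cong : (σ τ : Substitution X Y) {d e : Term Y} {x x′ : X} →
                d T.≈ e → (x ≢ x′ → σ x′ T.≈ τ x′) →
                (σ ^[ d / x ]) x′ T.≈ (τ ^[ e / x ]) x′
  update-cong σ τ {x = x} {x′} d≈e σ≈τ with em {P = x ≡ x′}
  ... | yes _   = d≈e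
  ... | no x≢x′ = σ≈τ x≢x′

  update-⨾ : ⦃ _ : NonEmpty Y ⦄ (σ : Substitution X Y) (τ : Substitution Y W) {d : Term Y} {x : X} →
             (σ ^[ d / x ]) ⨾ τ ≋ (σ ⨾ τ) ^[ d ⟨ τ ⟩ᵗ / x ]
  update-⨾ σ τ {x = x} x′ with em {P = x ≡ x′}
  ... | yes _ = T.refl
  ... | no _  = T.refl

  ⟨⟩-congʳ : ⦃ _ : NonEmpty X ⦄ {p : Formula X} {σ τ : Substitution X Y} →
             σ ≋ τ → p ⟨ σ ⟩ F.≈ p ⟨ τ ⟩
  ⟨⟩-congʳ = ⟨⟩-cong F.refl

  module _ ⦃ _ : NonEmpty X ⦄ (σ : Substitution X Y) where
    open IsBooleanHomomorphism (P4 σ) public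
      using () renaming (¬-homo to ⟨⟩-¬; ⊤-homo to ⟨⟩-⊤; ⊥-homo to ⟨⟩-⊥)
    open LatticeMorphisms.IsLatticeHomomorphism
      (IsBooleanHomomorphism.isLatticeHomomorphism (P4 σ)) public
      using () renaming (∧-homo to ⟨⟩-∧; ∨-homo to ⟨⟩-∨)

  ⟨⟩-mono : ⦃ _ : NonEmpty X ⦄ {p q : Formula X} (σ : Substitution X Y) →
            p O.≤ q → p ⟨ σ ⟩ O.≤ q ⟨ σ ⟩
  ⟨⟩-mono {p = p} {q} σ p≤q =
    F.trans (⟨⟩-cong p≤q (λ _ → T.refl)) (⟨⟩-∧ σ p q)

  forAll-mono : (x : X) {p q : Formula X} → p O.≤ q → forAll x p O.≤ forAll x q
  forAll-mono x {p} {q} p≤q = F.trans (forAll-cong x p≤q) (Q1 x p q)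

  -- By `P2` and `P3`, substituting σ after the renaming amounts to substituting σ ∘ f, which reads
  -- σ only on the image of f.
  renaming-support : ⦃ _ : NonEmpty X ⦄ ⦃ _ : NonEmpty Y ⦄ (f : X → Y) (p : Formula X) →
                     Supports (λ y → ∃[ x ] f x ≡ y) (p ⟨ var ∘ f ⟩)
  renaming-support f p σ τ σ≈τ =
    F.trans (P2 p (var ∘ f) σ) (F.trans (⟨⟩-congʳ pointwise) (F.sym (P2 p (var ∘ f) τ)))
    where
    pointwise : (var ∘ f) ⨾ σ ≋ (var ∘ f) ⨾ τ
    pointwise x = T.trans (P3 (f x) σ) (T.trans (σ≈τ (x , refl)) (T.sym (P3 (f x) τ)))

  -- P5 needs a variable of Y that σ avoids; Y may lack one, so it is adjoined.
  module _ ⦃ _ : NonEmpty X ⦄ ⦃ _ : NonEmpty Y ⦄ (x : X) (p : Formula X) where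
    private instance
      Maybe-nonEmpty : NonEmpty (Maybe Y)
      Maybe-nonEmpty = inhabited nothing

    underFreshBinder : Substitution X Y → Substitution X (Maybe Y)
    underFreshBinder σ = (σ ⨾ (var ∘ just)) ^[ var nothing / x ]

    -- The lifted σ avoids `nothing`, so `P5` takes it under the binder. Then ρ leads back to Y, and
    -- its value at `nothing` is free.
    forAll-freshBinder : (σ : Substitution X Y) (ρ : Substitution (Maybe Y) Y) → ρ ∘ just ≋ var →
      forAll x p ⟨ σ ⟩ F.≈ forAll nothing (p ⟨ underFreshBinder σ ⟩) ⟨ ρ ⟩
    forAll-freshBinder σ ρ ρ-retracts = begin
      forAll x p ⟨ σ ⟩                                   ≈⟨ ⟨⟩-congʳ retracted ⟨
      forAll x p ⟨ σ ⨾ (var ∘ just) ⨾ ρ ⟩                ≈⟨ P2 _ (σ ⨾ (var ∘ just)) ρ ⟨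
      forAll x p ⟨ σ ⨾ (var ∘ just) ⟩ ⟨ ρ ⟩
        ≈⟨ ⟨⟩-cong (P5 x p (σ ⨾ (var ∘ just)) nothing (just y₀) (λ ()) avoided) (λ _ → T.refl) ⟩
      forAll nothing (p ⟨ underFreshBinder σ ⟩) ⟨ ρ ⟩    ∎
      where
      open ≈-Reasoning F.setoid
      y₀ = element em {Y} it
      retracted : σ ⨾ (var ∘ just) ⨾ ρ ≋ σ
      retracted x′ = T.trans (P2ᵗ (σ x′) (var ∘ just) ρ) (T.trans
        (⟨⟩ᵗ-cong T.refl (λ y → T.trans (P3 (just y) ρ) (ρ-retracts y))) (P1ᵗ (σ x′)))
      avoided : σ ⨾ (var ∘ just) ⨾ [ var (just y₀) / nothing ] ≋ σ ⨾ (var ∘ just)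
      avoided x′ = T.trans (P2ᵗ (σ x′) (var ∘ just) _) (⟨⟩ᵗ-cong T.refl λ y →
        T.trans (P3 (just y) _) (T.reflexive (update-other var _ λ ())))

    -- Both substitutions under the fresh binder send x to `nothing`, so they agree on all of U, and
    -- the same ρ leads both back.
    forAll-support : {U : Pred X ℓ} → Supports U p → (σ τ : Substitution X Y) →
                     (∀ {x′} → x′ ∈ U → x ≢ x′ → σ x′ T.≈ τ x′) →
                     forAll x p ⟨ σ ⟩ F.≈ forAll x p ⟨ τ ⟩
    forAll-support {U} p-support σ τ σ≈τ = begin
      forAll x p ⟨ σ ⟩                                 ≈⟨ forAll-freshBinder σ ρ (λ _ → T.refl) ⟩
      forAll nothing (p ⟨ underFreshBinder σ ⟩) ⟨ ρ ⟩  ≈⟨ ⟨⟩-cong (forAll-cong nothing (p-support _ _ under))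
                                                             (λ _ → T.refl) ⟩
      forAll nothing (p ⟨ underFreshBinder τ ⟩) ⟨ ρ ⟩  ≈⟨ forAll-freshBinder τ ρ (λ _ → T.refl) ⟨
      forAll x p ⟨ τ ⟩                                 ∎
      where
      open ≈-Reasoning F.setoid
      ρ : Substitution (Maybe Y) Y
      -- An arbitrary term over Y.
      ρ nothing  = σ x
      ρ (just y) = var y
      under : ∀ {x′} → x′ ∈ U → underFreshBinder σ x′ T.≈ underFreshBinder τ x′
      under x′∈U = update-cong (σ ⨾ (var ∘ just)) (τ ⨾ (var ∘ just)) T.refl
        λ x≢x′ → ⟨⟩ᵗ-cong (σ≈τ x′∈U x≢x′) (λ _ → T.refl)

  -- Fresh variables and single Henkin axioms

  module _ ⦃ _ : NonEmpty X ⦄ where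

    -- Non-occurrence of c, expressed as invariance under renaming c, the form in which `Q3` takes
    -- it.
    Fresh : X → Formula X → Set ℓ
    Fresh c p = ∀ y → p ⟨ [ var y / c ] ⟩ F.≈ p

    private
      off-c : {c y x : X} → c ≢ x → [ var y / c ] x T.≈ var x
      off-c c≢x = T.reflexive (update-other var _ c≢x)

    support⇒fresh : {U : Pred X ℓ} {c : X} {p : Formula X} → Supports U p → c ∉ U → Fresh c p
    support⇒fresh {U} {c} p-support c∉U y = F.trans
      (p-support _ _ λ x∈U → off-c λ { refl → c∉U x∈U })
      (P1 _)

    fresh-∧ : ∀ {c} {p q : Formula X} → Fresh c p → Fresh c q → Fresh c (p F.∧ q)
    fresh-∧ {c} {p} {q} p-fresh q-fresh y =
      F.trans (⟨⟩-∧ _ p q) (F.∧-cong (p-fresh y) (q-fresh y))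

    fresh-∨ : ∀ {c} {p q : Formula X} → Fresh c p → Fresh c q → Fresh c (p F.∨ q)
    fresh-∨ {c} {p} {q} p-fresh q-fresh y =
      F.trans (⟨⟩-∨ _ p q) (F.∨-cong (p-fresh y) (q-fresh y))

    fresh-¬ : ∀ {c} {p : Formula X} → Fresh c p → Fresh c (F.¬ p)
    fresh-¬ {c} {p} p-fresh y = F.trans (⟨⟩-¬ _ p) (F.¬-cong (p-fresh y))

    fresh-⊤ : ∀ {c} → Fresh c F.⊤
    fresh-⊤ y = ⟨⟩-⊤ _

    module _ {U : Pred X ℓ} {q : Formula X} (q-support : Supports U q) where

      fresh-forAll : ∀ {c} (z : X) → c ∉ U → Fresh c (forAll z q)
      fresh-forAll {c} z c∉U y = F.trans
        (forAll-support z q q-support _ var λ x∈U _ → off-c λ { refl → c∉U x∈U })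
        (P1 _)

      fresh-instance : ∀ {c z c′} → c ∉ U → c ≢ c′ → Fresh c (q ⟨ [ var c′ / z ] ⟩)
      fresh-instance {c} {z} {c′} c∉U c≢c′ y = F.trans (P2 q _ _) (q-support _ _ λ {x} x∈U →
        T.trans (update-⨾ var σ x) (update-cong (var ⨾ σ) var (T.trans (P3 c′ σ) (off-c c≢c′)) λ _ →
          T.trans (P3 x σ) (off-c λ { refl → c∉U x∈U })))
        where
        σ : Substitution X X
        σ = [ var y / c ]

      -- Change of bound variable. The identity does not avoid c, so `P5` is applied to [z/c]
      -- instead, which avoids c and fixes ∀z.q because c is outside the support.
      forAll-rename : ∀ {c z} → c ∉ U → c ≢ z → forAll c (q ⟨ [ var c / z ] ⟩) F.≈ forAll z q
      forAll-rename {c} {z} c∉U c≢z = begin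
        forAll c (q ⟨ [ var c / z ] ⟩)     ≈⟨ forAll-cong c (q-support _ _ renamed) ⟨
        forAll c (q ⟨ σ ^[ var c / z ] ⟩)  ≈⟨ P5 z q σ c z c≢z avoided ⟨
        forAll z q ⟨ σ ⟩                   ≈⟨ fresh-forAll z c∉U z ⟩
        forAll z q                         ∎
        where
        open ≈-Reasoning F.setoid
        σ : Substitution X X
        σ = [ var z / c ]
        renamed : ∀ {x} → x ∈ U → (σ ^[ var c / z ]) x T.≈ [ var c / z ] x
        renamed x∈U = update-cong σ var T.refl λ _ → off-c λ { refl → c∉U x∈U }
        avoided : σ ⨾ σ ≋ σ
        avoided x = T.trans (update-⨾ var σ x) (update-cong (var ⨾ σ) var
          (T.trans (P3 z σ) (off-c c≢z)) λ c≢x → T.trans (P3 x σ) (off-c c≢x))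

      -- Freshness of c lets r ≤ q[c/z] be generalized to r ≤ ∀z.q, so r lies below the very axiom
      -- it would refute.
      henkin-consistent : ∀ {c z} {r : Formula X} → c ∉ U → c ≢ z → Fresh c r → r F.≉ F.⊥ →
        r F.∧ (forAll z q F.∨ F.¬ (q ⟨ [ var c / z ] ⟩)) F.≉ F.⊥
      henkin-consistent {c} {z} {r} c∉U c≢z r-fresh r≉⊥ eq = r≉⊥ (≤⊥⇒≈⊥ (begin
        r                              ≤⟨ ∧-greatest ≤-refl r≤∀q ⟩
        r F.∧ forAll z q               ≤⟨ ∧-mono ≤-refl (x≤x∨y _ _) ⟩
        r F.∧ (forAll z q F.∨ F.¬ b)   ≈⟨ eq ⟩
        F.⊥                            ∎))
        where
        open BooleanOrder (Formulas X)
        open ≤-Reasoning (BooleanAlgebraProperties.poset (Formulas X))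
        b = q ⟨ [ var c / z ] ⟩
        r≤b : r O.≤ b
        r≤b = ∧∁≈⊥⇒≤ (≤⊥⇒≈⊥ (≤-trans (∧-mono ≤-refl (y≤x∨y _ _)) (≤-reflexive eq)))
        r≤∀q : r O.≤ forAll z q
        r≤∀q = begin
          -- `Q3` asks for a second variable besides c; the bound variable z serves.
          r           ≈⟨ Q3 c z r (c≢z ∘ sym) (r-fresh z) ⟨
          forAll c r  ≤⟨ forAll-mono c r≤b ⟩
          forAll c b  ≈⟨ forAll-rename c∉U c≢z ⟩
          forAll z q  ∎

-- Henkin constants

ℕ-injection⇒infinite : ∀ {a} {X : Set a} (f : ℕ → X) → Injective _≡_ _≡_ f → Infinite X
ℕ-injection⇒infinite f f-injective (n , iso) = ℕ.1+n≰n
  (Fin.injective⇒≤ {m = suc n} {f = to ∘ f ∘ Fin.toℕ} λ {i} {j} eq →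
    Fin.toℕ-injective (f-injective (trans (sym (strictlyInverseʳ (f (Fin.toℕ i))))
      (trans (cong from eq) (strictlyInverseʳ (f (Fin.toℕ j)))))))
  where open Inverse iso

-- node q z xs is the Henkin constant witnessing ∃ z. ¬ q, where the nth
-- variable of q stands for the nth member of xs, or for z if there is none.
-- Constants occurring in it are subtrees of node q z xs, so that a constant of
-- maximal size in a finite set is fresh for the axioms of the others.

data HenkinVar {ℓ} (Q X : Set ℓ) : Set ℓ where
  base : X → HenkinVar Q X
  node : Q → HenkinVar Q X → List (HenkinVar Q X) → HenkinVar Q X

module _ {ℓ} {Q X : Set ℓ} where
  private
    V = HenkinVar Q X

  -- The height of the tree, not its number of nodes.
  size  : V → ℕ
  sizes : List V → ℕ
  size (base _)      = zero
  size (node _ z xs) = suc (size z ℕ.⊔ sizes xs)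
  sizes []       = zero
  sizes (x ∷ xs) = size x ℕ.⊔ sizes xs

  select : V → List V → ℕ → V
  select z []       _       = z
  select z (x ∷ xs) zero    = x
  select z (x ∷ xs) (suc n) = select z xs n

  -- The bound is one less than the size of `node q z xs`, so a constant is never among the
  -- variables that it names.
  size-select : ∀ z xs n → size (select z xs n) ℕ.≤ size z ℕ.⊔ sizes xs
  size-select z []       n       = ℕ.m≤m⊔n _ _
  size-select z (x ∷ xs) zero    = ℕ.≤-trans (ℕ.m≤m⊔n (size x) (sizes xs)) (ℕ.m≤n⊔m (size z) _)
  size-select z (x ∷ xs) (suc n) = ℕ.≤-trans (size-select z xs n)
    (ℕ.⊔-monoʳ-≤ (size z) (ℕ.m≤n⊔m (size x) (sizes xs)))

  ∈⇒select : ∀ z {x xs} → x ∈ₗ xs → ∃[ n ] select z xs n ≡ x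
  ∈⇒select z (here refl)  = zero , refl
  ∈⇒select z (there x∈xs) = let n , eq = ∈⇒select z x∈xs in suc n , eq

  base-injective : Injective _≡_ _≡_ (base {Q = Q} {X})
  base-injective refl = refl

  henkinVar-infinite : Q → X → Infinite V
  henkinVar-infinite q x = ℕ-injection⇒infinite tower λ {m} {n} eq →
    trans (sym (size-tower m)) (trans (cong size eq) (size-tower n))
    where
    tower : ℕ → V
    tower zero    = base x
    tower (suc n) = node q (tower n) []
    size-tower : ∀ n → size (tower n) ≡ n
    size-tower zero    = refl
    size-tower (suc n) = cong suc (trans (ℕ.⊔-identityʳ _) (size-tower n))

-- Consistency of the Henkin axioms and the perfect extension

module Extension (em : ∀ {a} → ExcludedMiddle a) (ext : ∀ {a b} → Extensionality a b)
                 {ℓ} (A : QuantifierTheory em (AllSets ℓ))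
                 (locallyFinite : QuantifierTheory.LocallyFinite A)
                 (X : Set ℓ) (X-infinite : Infinite X) (J : Pred (QuantifierTheory.Formula A X) ℓ)
                 (J-consistent : Filters.Consistent (QuantifierTheory.Formulas A X) J) where
  open QuantifierTheory A
  open Theory em A
  open LocallyFinite locallyFinite

  -- Formulas over X⁺ cannot index the constants from which X⁺ is built. By local finiteness each is
  -- a renaming of a formula in countably many variables, and those exist beforehand.
  N : Set ℓ
  N = Lift ℓ ℕ

  X⁺ : Set ℓ
  X⁺ = HenkinVar (Formula N) X

  x₀ : X
  x₀ = element em (infinite⇒nonEmpty X-infinite)

  instance
    N-nonEmpty : NonEmpty N
    N-nonEmpty = inhabited (lift zero)
    X-nonEmpty : NonEmpty X
    X-nonEmpty = infinite⇒nonEmpty X-infinite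
    X⁺-nonEmpty : NonEmpty X⁺
    X⁺-nonEmpty = inhabited (base x₀)

  open BooleanOrder (Formulas X⁺)

  record Witness : Set ℓ where
    constructor mkWitness
    field
      matrix : Formula N
      bound  : X⁺
      others : List X⁺

    constant : X⁺
    constant = node matrix bound others

    names : N → X⁺
    names = select bound others ∘ lower

    body : Formula X⁺
    body = matrix ⟨ var ∘ names ⟩

    axiom : Formula X⁺
    axiom = forAll bound body F.∨ F.¬ (body ⟨ [ var constant / bound ] ⟩)

    body-support : Supports (λ y → ∃[ n ] names n ≡ y) body
    body-support = renaming-support names matrix

  open Witness

  -- Every variable named by w is strictly smaller than the constant of w, hence than c.
  fresh-body : ∀ w {c} → size (constant w) ℕ.≤ size c → ¬ (∃[ n ] names w n ≡ c)
  fresh-body w ≤c (n , refl) = ℕ.1+n≰n (ℕ.≤-trans ≤c (size-select (bound w) (others w) (lower n)))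

  constant≢bound : ∀ w → constant w ≢ bound w
  constant≢bound w eq = ℕ.1+n≰n (ℕ.≤-trans (ℕ.≤-reflexive (cong size eq)) (ℕ.m≤m⊔n _ _))

  constant-injective : ∀ {w w′} → constant w ≡ constant w′ → w ≡ w′
  constant-injective refl = refl

  fresh-axiom : ∀ w {c} → size (constant w) ℕ.≤ size c → c ≢ constant w → Fresh c (axiom w)
  fresh-axiom w ≤c c≢ = fresh-∨
    (fresh-forAll (body-support w) (bound w) (fresh-body w ≤c))
    (fresh-¬ (fresh-instance (body-support w) (fresh-body w ≤c) c≢))

  fresh-⋀ : ∀ {c L} → All (Fresh c) L → Fresh c (⋀ L)
  fresh-⋀ []          = fresh-⊤
  fresh-⋀ (pf ∷ fresh) = fresh-∧ pf (fresh-⋀ fresh)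

  κ : X → X⁺
  κ = base

  F₀ : Pred (Formula X) ℓ
  F₀ = proj₁ J-consistent

  open Filters.IsProperFilter (proj₁ (proj₂ J-consistent)) renaming (isFilter to F₀-isFilter)

  -- `κ` has a left inverse, so p can be recovered from its translate.
  embed-≉⊥ : ∀ {p} → p ∈ F₀ → p ⟨ var ∘ κ ⟩ F.≉ F.⊥
  embed-≉⊥ {p} p∈F₀ eq = proper (↑-closed (BooleanOrder.≤-reflexive (Formulas X) p≈⊥) p∈F₀)
    where
    open Filters.IsFilter F₀-isFilter
    open ≈-Reasoning (F.setoid {X})
    retract : Substitution X⁺ X
    retract (base x)     = var x
    -- An arbitrary value: no Henkin constant lies in the image of `κ`.
    retract (node _ _ _) = var x₀
    p≈⊥ : p F.≈ F.⊥
    p≈⊥ = begin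
      p                             ≈⟨ P1 p ⟨
      p ⟨ var ⟩                     ≈⟨ ⟨⟩-congʳ (λ x → P3 (base x) retract) ⟨
      p ⟨ (var ∘ κ) ⨾ retract ⟩     ≈⟨ P2 p (var ∘ κ) retract ⟨
      p ⟨ var ∘ κ ⟩ ⟨ retract ⟩     ≈⟨ ⟨⟩-cong eq (λ _ → T.refl) ⟩
      F.⊥ ⟨ retract ⟩               ≈⟨ ⟨⟩-⊥ retract ⟩
      F.⊥                           ∎

  -- The axiom removed need not be the head and may be repeated, and all its copies must go before
  -- its constant is fresh for the rest; hence the recursion on length.
  axioms-consistent : ∀ {p} → p ∈ F₀ → ∀ ws → Acc ℕ._<_ (length ws) →
                      p ⟨ var ∘ κ ⟩ F.∧ ⋀ (map axiom ws) F.≉ F.⊥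
  axioms-consistent {p} p∈F₀ [] _ eq =
    embed-≉⊥ p∈F₀ (≤⊥⇒≈⊥ (≤-trans (∧-greatest ≤-refl (≤⊤ _)) (≤-reflexive eq)))
  axioms-consistent {p} p∈F₀ ws@(w₀ ∷ ws₀) (acc rec) eq =
    henkin-consistent (body-support w) (fresh-body w ℕ.≤-refl) (constant≢bound w)
      -- The translate of p is supported by the image of `κ`, which contains no `node`.
      (fresh-∧ (support⇒fresh (renaming-support κ p) λ ()) (fresh-⋀ (All.tabulate fresh-rest)))
      (axioms-consistent p∈F₀ rest (rec (filter-notAll ≢w? ws (lose w∈ws λ w≢w → w≢w refl))))
      (≤⊥⇒≈⊥ (≤-trans (∧-greatest (≤-trans (x∧y≤x _ _) (x∧y≤x _ _)) (⋀-greatest (All.tabulate covered)))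
        (≤-reflexive eq)))
    where
    rank : Witness → ℕ
    rank = size ∘ constant
    w : Witness
    w = argmax rank w₀ ws₀
    w∈ws : w ∈ₗ ws
    w∈ws = [ here , there ]′ (argmax-sel rank w₀ ws₀)
    ≢w? : ∀ w′ → Dec (w′ ≢ w)
    ≢w? _ = em
    rest = filter ≢w? ws
    rank≤ : All (λ w′ → rank w′ ℕ.≤ rank w) ws
    rank≤ = f[⊥]≤f[argmax] {f = rank} w₀ ws₀ ∷ f[xs]≤f[argmax] {f = rank} w₀ ws₀
    fresh-rest : ∀ {q} → q ∈ₗ map axiom rest → Fresh (constant w) q
    fresh-rest q∈ with ∈-map⁻ axiom q∈
    ... | w′ , w′∈rest , refl with ∈-filter⁻ ≢w? {xs = ws} w′∈rest
    ...   | w′∈ws , w′≢w = fresh-axiom w′ (All.lookup rank≤ w′∈ws) (w′≢w ∘ sym ∘ constant-injective)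
    covered : ∀ {q} → q ∈ₗ map axiom ws →
              (p ⟨ var ∘ κ ⟩ F.∧ ⋀ (map axiom rest)) F.∧ axiom w O.≤ q
    covered q∈ with ∈-map⁻ axiom q∈
    ... | w′ , w′∈ws , refl with em {P = w′ ≡ w}
    ...   | yes refl = x∧y≤y _ _
    ...   | no w′≢w  = ≤-trans (x∧y≤x _ _) (≤-trans (x∧y≤y _ _)
                         (⋀-lower (∈-map⁺ axiom (∈-filter⁺ ≢w? w′∈ws w′≢w))))

  -- The proper filter F₀ around J is used instead of J: its closure under meets reduces finitely
  -- many translates to one.
  G : Pred (Formula X⁺) ℓ
  G q = (∃[ p ] p ∈ F₀ × p ⟨ var ∘ κ ⟩ ≡ q) ⊎ (∃[ w ] axiom w ≡ q)

  G-fip : ∀ L → All (_∈ G) L → ⋀ L F.≉ F.⊥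
  G-fip L L⊆G eq with split L⊆G
    where
    open Filters.IsFilter F₀-isFilter
    split : ∀ {L} → All (_∈ G) L →
            ∃[ p ] ∃[ ws ] p ∈ F₀ × p ⟨ var ∘ κ ⟩ F.∧ ⋀ (map axiom ws) O.≤ ⋀ L
    split [] = F.⊤ , [] , ⊤-closed , ≤⊤ _
    split (g ∷ gs) with split gs
    split (inj₂ (w , refl) ∷ gs) | p , ws , p∈F₀ , ≤L =
      p , w ∷ ws , p∈F₀ , ∧-greatest (≤-trans (x∧y≤y _ _) (x∧y≤x _ _))
        (≤-trans (∧-mono ≤-refl (x∧y≤y _ _)) ≤L)
    split (inj₁ (p′ , p′∈F₀ , refl) ∷ gs) | p , ws , p∈F₀ , ≤L =
      p′ F.∧ p , ws , ∧-closed p′∈F₀ p∈F₀ , ≤-trans (∧-mono (≤-reflexive (⟨⟩-∧ (var ∘ κ) p′ p)) ≤-refl)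
        (∧-greatest (≤-trans (x∧y≤x _ _) (x∧y≤x _ _))
          (≤-trans (∧-mono (x∧y≤y _ _) ≤-refl) ≤L))
  ... | p , ws , p∈F₀ , ≤L =
    axioms-consistent p∈F₀ ws (<-wellFounded _) (≤⊥⇒≈⊥ (≤-trans ≤L (≤-reflexive eq)))

  open Ultrafilters em (Formulas X⁺)

  I : Pred (Formula X⁺) ℓ
  I = proj₁ (ultrafilter-lemma ext G G-fip)
  I-ultra : Filters.IsUltrafilter (Formulas X⁺) I
  I-ultra = proj₁ (proj₂ (ultrafilter-lemma ext G G-fip))
  G⊆I : G ⊆ I
  G⊆I = proj₂ (proj₂ (ultrafilter-lemma ext G G-fip))

  -- The members of a finite support of q are renamed to their positions in the list; reading the
  -- list renames them back.
  witnessFor : ∀ z q → ∃[ w ] bound w ≡ z × body w F.≈ q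
  witnessFor z q = mkWitness (q ⟨ var ∘ position ⟩) z xs , refl , (begin
    q ⟨ var ∘ position ⟩ ⟨ var ∘ pick ⟩    ≈⟨ P2 q (var ∘ position) (var ∘ pick) ⟩
    q ⟨ (var ∘ position) ⨾ (var ∘ pick) ⟩  ≈⟨ xs-support _ _ picked ⟩
    q ⟨ var ⟩                              ≈⟨ P1 q ⟩
    q                                      ∎)
    where
    open ≈-Reasoning (F.setoid {X⁺})
    xs = proj₁ (finiteSupport q)
    xs-support = proj₂ (finiteSupport q)
    pick : N → X⁺
    pick = select z xs ∘ lower
    -- Outside xs, a support of q, the value is irrelevant.
    position : X⁺ → N
    position x with em {P = ∃[ n ] select z xs n ≡ x}
    ... | yes (n , _) = lift n
    ... | no _        = lift zero
    pick-position : ∀ {x} → x ∈ₗ xs → pick (position x) ≡ x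
    pick-position {x} x∈xs with em {P = ∃[ n ] select z xs n ≡ x}
    ... | yes (_ , eq) = eq
    ... | no none      = contradiction (∈⇒select z x∈xs) none
    picked : ∀ {x} → x ∈ₗ xs → ((var ∘ position) ⨾ (var ∘ pick)) x T.≈ var x
    picked {x} x∈xs = T.trans (P3 (position x) _) (T.reflexive (cong var (pick-position x∈xs)))

  I-perfect : IsPerfect A X⁺ I
  I-perfect = record { isUltrafilter = I-ultra ; witness = witness }
    where
    open Filters.IsUltrafilter I-ultra
    open Filters.IsFilter isFilter
    witness : ∀ z q → ∃[ d ] forAll z q F.∨ F.¬ (q ⟨ [ d / z ] ⟩) ∈ I
    witness z q with witnessFor z q
    -- The encoded body is q only up to `≈`, so the axiom is carried along this equality.
    ... | w , refl , body≈q = var (constant w) , ↑-closed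
      (≤-reflexive (F.∨-cong (forAll-cong z body≈q) (F.¬-cong (⟨⟩-cong body≈q λ _ → T.refl))))
      (G⊆I (inj₂ (w , refl)))

  extension : IsPerfectExtension A X-infinite J X⁺ κ I
  extension = record
    { infinite    = henkinVar-infinite F.⊤ x₀
    ; κ-injective = base-injective
    ; isPerfect   = I-perfect
    ; J⊆I         = λ p∈J → G⊆I (inj₁ (_ , proj₂ (proj₂ J-consistent) p∈J , refl))
    }

-- The quotient by a perfect ultrafilter

unique⇒lookup-injective : ∀ {a} {X : Set a} {xs : List X} → Unique xs →
                          ∀ {i j} → lookup xs i ≡ lookup xs j → i ≡ j
unique⇒lookup-injective (_ ∷ _)   {Fin.zero}  {Fin.zero}  _  = refl
unique⇒lookup-injective (x∉ ∷ _)  {Fin.zero}  {Fin.suc j} eq =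
  contradiction eq (All.lookup x∉ (∈-lookup j))
unique⇒lookup-injective (x∉ ∷ _)  {Fin.suc i} {Fin.zero}  eq =
  contradiction (sym eq) (All.lookup x∉ (∈-lookup i))
unique⇒lookup-injective (_ ∷ xs!) {Fin.suc i} {Fin.suc j} eq =
  cong Fin.suc (unique⇒lookup-injective xs! eq)

-- A list exhausting X would, after removal of repetitions, be a bijection with some `Fin n`.
infinite⇒∃∉ : (∀ {a} → ExcludedMiddle a) → ∀ {a} {X : Set a} →
              Infinite X → (xs : List X) → ∃[ x ] x ∉ₗ xs
infinite⇒∃∉ em {X = X} X-infinite xs = decidable-stable em λ none →
  let listed = λ x → ∈-deduplicate⁺ _≟_ {xs} {x} (decidable-stable em λ x∉xs → none (x , x∉xs)) in
  X-infinite (length ys , mk↔ₛ′ (index ∘ listed) (lookup ys)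
    (λ i → unique⇒lookup-injective (deduplicate-! _≟_ xs) (sym (lookup-index (listed (lookup ys i)))))
    (λ x → sym (lookup-index (listed x))))
  where
  _≟_ : DecidableEquality X
  x ≟ y = em
  ys = deduplicate _≟_ xs

module Quotient {ℓ} (B : BooleanAlgebra ℓ ℓ) {F : Pred (BooleanAlgebra.Carrier B) ℓ}
                (F-isFilter : Filters.IsFilter B F) where
  open BooleanAlgebra B hiding (refl; sym; trans)
  private module B = BooleanAlgebra B
  open BooleanOrder B
  open Filters.IsFilter F-isFilter
  open BooleanAlgebra (quotient B F-isFilter) public using () renaming (_≈_ to _∼_)

  ≈⇒∼ : ∀ {p q} → p ≈ q → p ∼ q
  ≈⇒∼ p≈q = ⊤ , ⊤-closed , ∧-congʳ p≈q

  ∈-resp-∼ : ∀ {p q} → p ∼ q → p ∈ F → q ∈ F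
  ∈-resp-∼ (r , r∈F , eq) p∈F =
    ↑-closed (≤-trans (≤-reflexive eq) (x∧y≤x _ _)) (∧-closed p∈F r∈F)

  both∈⇒∼ : ∀ {p q} → p ∈ F → q ∈ F → p ∼ q
  both∈⇒∼ {p} {q} p∈F q∈F = p ∧ q , ∧-closed p∈F q∈F ,
    B.trans (≤-antisym (x∧y≤y _ _) (∧-greatest (x∧y≤x _ _) ≤-refl))
            (≤-antisym (∧-greatest (x∧y≤y _ _) ≤-refl) (x∧y≤y _ _))

  ∈⇒∼⊤ : ∀ {p} → p ∈ F → p ∼ ⊤
  ∈⇒∼⊤ p∈F = both∈⇒∼ p∈F ⊤-closed

module UltrafilterQuotient (em : ∀ {a} → ExcludedMiddle a) {ℓ} (B : BooleanAlgebra ℓ ℓ)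
                           {I : Pred (BooleanAlgebra.Carrier B) ℓ}
                           (I-ultra : Filters.IsUltrafilter B I) where
  open BooleanAlgebra B hiding (refl; sym; trans) renaming (¬_ to infix 8 ∁_)
  private module B = BooleanAlgebra B
  open BooleanOrder B
  open BooleanAlgebraProperties B using (∧-zeroˡ)
  open Ultrafilters em B
  open Filters.IsUltrafilter I-ultra
  open Filters.IsFilter isFilter
  open Quotient B isFilter
  open Order (quotient B isFilter) using () renaming (_≤_ to _≤∼_)

  ∉⇒∼⊥ : ∀ {p} → p ∉ I → p ∼ ⊥
  ∉⇒∼⊥ {p} p∉I = ∁ p , ∉⇒∁-∈ I-ultra p∉I , B.trans (∧-complementʳ p) (B.sym (∧-zeroˡ _))

  both∉⇒∼ : ∀ {p q} → p ∉ I → q ∉ I → p ∼ q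
  both∉⇒∼ p∉I q∉I = Q.trans (∉⇒∼⊥ p∉I) (Q.sym (∉⇒∼⊥ q∉I))
    where module Q = BooleanAlgebra (quotient B isFilter)

  ≤∼⇒∈ : ∀ {p q} → p ≤∼ q → p ∈ I → q ∈ I
  ≤∼⇒∈ p≤q p∈I = ↑-closed (x∧y≤y _ _) (∈-resp-∼ p≤q p∈I)

  -- With `≤∼⇒∈` this turns the order of the quotient into implication between memberships, so that
  -- infima are tested inside I.
  ∈⇒≤∼ : ∀ {p q} → (p ∈ I → q ∈ I) → p ≤∼ q
  ∈⇒≤∼ {p} {q} p∈⇒q∈ with em {P = p ∈ I}
  ... | yes p∈I = both∈⇒∼ p∈I (∧-closed p∈I (p∈⇒q∈ p∈I))
  ... | no p∉I  = both∉⇒∼ p∉I λ pq∈I → p∉I (↑-closed (x∧y≤x _ _) pq∈I)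

  truth : Carrier → Bool
  truth p = does (em {P = p ∈ I})

  quotient≅2 : IsBooleanIsomorphism (quotient B isFilter) ∨-∧-booleanAlgebra truth
  quotient≅2 = record
    { isBooleanHomomorphism = record
      { isLatticeHomomorphism = record
        { isRelHomomorphism = record { cong = truth-cong }
        ; ∧-homo = truth-∧
        ; ∨-homo = truth-∨
        }
      ; ¬-homo = truth-¬
      ; ⊤-homo = truth-⊤
      ; ⊥-homo = truth-⊥
      }
    ; injective  = truth-injective
    ; surjective = λ { true → ⊤ , λ p∼⊤ → trans (truth-cong p∼⊤) truth-⊤
                     ; false → ⊥ , λ p∼⊥ → trans (truth-cong p∼⊥) truth-⊥ }
    }
    where
    truth-cong : ∀ {p q} → p ∼ q → truth p ≡ truth q
    truth-cong {p} {q} p∼q with em {P = p ∈ I}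
    ... | yes p∈I = sym (dec-true em (∈-resp-∼ p∼q p∈I))
    ... | no p∉I  = sym (dec-false em (p∉I ∘ ∈-resp-∼ (BooleanAlgebra.sym (quotient B isFilter) p∼q)))
    truth-injective : ∀ {p q} → truth p ≡ truth q → p ∼ q
    truth-injective {p} {q} eq with em {P = p ∈ I} | em {P = q ∈ I}
    ... | yes p∈I | yes q∈I = both∈⇒∼ p∈I q∈I
    ... | no p∉I  | no q∉I  = both∉⇒∼ p∉I q∉I
    truth-⊤ : truth ⊤ ≡ true
    truth-⊤ = dec-true em ⊤-closed
    truth-⊥ : truth ⊥ ≡ false
    truth-⊥ = dec-false em (⊥∉ I-ultra)
    truth-∧ : ∀ p q → truth (p B.∧ q) ≡ truth p and truth q
    truth-∧ p q with em {P = p ∈ I} | em {P = q ∈ I}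
    ... | yes p∈I | yes q∈I = dec-true em (∧-closed p∈I q∈I)
    ... | yes _   | no q∉I  = dec-false em (q∉I ∘ ↑-closed (x∧y≤y p q))
    ... | no p∉I  | _       = dec-false em (p∉I ∘ ↑-closed (x∧y≤x p q))
    truth-¬ : ∀ p → truth (∁ p) ≡ not (truth p)
    truth-¬ p with em {P = p ∈ I}
    ... | yes p∈I = dec-false em (∁-∉ I-ultra p∈I)
    ... | no p∉I  = dec-true em (∉⇒∁-∈ I-ultra p∉I)
    truth-∨ : ∀ p q → truth (p B.∨ q) ≡ truth p or truth q
    truth-∨ p q with em {P = p ∈ I} | em {P = q ∈ I}
    ... | yes p∈I | _       = dec-true em (↑-closed (x≤x∨y p q) p∈I)
    ... | no _    | yes q∈I = dec-true em (↑-closed (y≤x∨y p q) q∈I)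
    ... | no p∉I  | no q∉I  = dec-false em λ p∨q∈I → p∉I (↑-closed
      (disjunctive-syllogism (∧-complementʳ q)) (∧-closed p∨q∈I (∉⇒∁-∈ I-ultra q∉I)))

-- The two-valued model given by a perfect ultrafilter

module PerfectModel (em : ∀ {a} → ExcludedMiddle a)
                    {ℓ} (A : QuantifierTheory em (AllSets ℓ))
                    (locallyFinite : QuantifierTheory.LocallyFinite A)
                    {Z : Set ℓ} (Z-infinite : Infinite Z) {I : Pred (QuantifierTheory.Formula A Z) ℓ}
                    (I-perfect : IsPerfect A Z I) where
  open QuantifierTheory A
  open Theory em A
  open LocallyFinite locallyFinite
  open IsPerfect I-perfect using (isFilter; isUltrafilter; witness)
  open Filters.IsFilter isFilter
  open BooleanOrder (Formulas Z)
  open Quotient (Formulas Z) isFilter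
  open UltrafilterQuotient em (Formulas Z) isUltrafilter

  instance
    Z-nonEmpty : NonEmpty Z
    Z-nonEmpty = infinite⇒nonEmpty Z-infinite

  ∈-resp-≈ : ∀ {p q} → p F.≈ q → p ∈ I → q ∈ I
  ∈-resp-≈ p≈q = ↑-closed (≤-reflexive p≈q)

  module _ {X : Set ℓ} ⦃ _ : NonEmpty X ⦄ (x : X) (p : Formula X) (σ : Substitution X Z) where

    -- The left side does not depend on the value of σ at x, so σ may be altered there before `Q2`
    -- is applied.
    forAll-lower : ∀ d → forAll x p ⟨ σ ⟩ O.≤ p ⟨ σ ^[ d / x ] ⟩
    forAll-lower d = ≤-trans
      (≤-reflexive (forAll-support x p everything σ _ λ _ x≢x′ →
        T.reflexive (sym (update-other σ d x≢x′))))
      (⟨⟩-mono _ (Q2 x p))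
      where
      everything : Supports (λ _ → Unit.⊤) p
      everything σ τ σ≈τ = ⟨⟩-congʳ λ x′ → σ≈τ {x′} _

    -- P5 needs a substitution that avoids some variable y, so σ is first made
    -- constant outside a finite support of p.
    forAll∈ : (∀ d → p ⟨ σ ^[ d / x ] ⟩ ∈ I) → forAll x p ⟨ σ ⟩ ∈ I
    -- Perfectness at y and q gives d. The instance q[d/y] is the instance of p at d, hence in I,
    -- which leaves the disjunct ∀y.q.
    forAll∈ instances∈ = let d , witnessed = witness y q in
      ∈-resp-≈ forAll-q (↑-closed (disjunctive-syllogism (F.∧-complementˡ _))
        (∧-closed witnessed (∈-resp-≈ (F.sym (instance-q d)) (instances∈ d))))
      where
      open ≈-Reasoning (F.setoid {Z})
      z₀ : Z
      z₀ = element em Z-nonEmpty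
      xs : List X
      xs = proj₁ (finiteSupport p)
      xs-support : Supports (_∈ₗ xs) p
      xs-support = proj₂ (finiteSupport p)
      σ′ : Substitution X Z
      σ′ x′ with em {P = x′ ∈ₗ xs}
      ... | yes _ = σ x′
      ... | no _  = var z₀
      σ′-agrees : ∀ {x′} → x′ ∈ₗ xs → σ′ x′ T.≈ σ x′
      σ′-agrees {x′} x′∈xs with em {P = x′ ∈ₗ xs}
      ... | yes _    = T.refl
      ... | no x′∉xs = contradiction x′∈xs x′∉xs
      varsOf : X → List Z
      varsOf x′ = proj₁ (finiteSupportᵗ (σ x′))
      -- Outside the supports of all values of σ on xs, and different from z₀, which also serves as
      -- the second variable in `P5`.
      y : Z
      y = proj₁ (infinite⇒∃∉ em Z-infinite (z₀ ∷ concatMap varsOf xs))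
      y∉ : y ∉ₗ z₀ ∷ concatMap varsOf xs
      y∉ = proj₂ (infinite⇒∃∉ em Z-infinite (z₀ ∷ concatMap varsOf xs))
      σ′-avoids-y : ∀ d → σ′ ⨾ [ d / y ] ≋ σ′
      σ′-avoids-y d x′ with em {P = x′ ∈ₗ xs}
      ... | yes x′∈xs = T.trans
              (proj₂ (finiteSupportᵗ (σ x′)) [ d / y ] var λ z∈ → T.reflexive (update-other var d
                λ { refl → y∉ (there (∈-concatMap⁺ varsOf (lose x′∈xs z∈))) }))
              (P1ᵗ (σ x′))
      ... | no _      = T.trans (P3 z₀ _) (T.reflexive (update-other var d (y∉ ∘ here)))
      q : Formula Z
      q = p ⟨ σ′ ^[ var y / x ] ⟩
      forAll-q : forAll y q F.≈ forAll x p ⟨ σ ⟩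
      forAll-q = begin
        forAll y q         ≈⟨ P5 x p σ′ y z₀ (y∉ ∘ here) (σ′-avoids-y (var z₀)) ⟨
        forAll x p ⟨ σ′ ⟩  ≈⟨ forAll-support x p xs-support σ′ σ (λ x′∈xs _ → σ′-agrees x′∈xs) ⟩
        forAll x p ⟨ σ ⟩   ∎
      instance-q : ∀ d → q ⟨ [ d / y ] ⟩ F.≈ p ⟨ σ ^[ d / x ] ⟩
      instance-q d = begin
        q ⟨ [ d / y ] ⟩                          ≈⟨ P2 p _ _ ⟩
        p ⟨ (σ′ ^[ var y / x ]) ⨾ [ d / y ] ⟩    ≈⟨ xs-support _ _ pointwise ⟩
        p ⟨ σ ^[ d / x ] ⟩                       ∎
        where
        pointwise : ∀ {x′} → x′ ∈ₗ xs →
                    ((σ′ ^[ var y / x ]) ⨾ [ d / y ]) x′ T.≈ (σ ^[ d / x ]) x′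
        pointwise {x′} x′∈xs = T.trans (update-⨾ σ′ [ d / y ] x′)
          (update-cong (σ′ ⨾ [ d / y ]) σ
            (T.trans (P3 y [ d / y ]) (T.reflexive (update-same var d y)))
            λ _ → T.trans (σ′-avoids-y d x′) (σ′-agrees x′∈xs))

    forAll-isInfimum : Order.IsInfimum (quotient (Formulas Z) isFilter)
      (λ d → p ⟨ σ ^[ d / x ] ⟩) (forAll x p ⟨ σ ⟩)
    forAll-isInfimum = record
      { lowerBound = λ d → ∈⇒≤∼ (↑-closed (forAll-lower d))
      ; greatest   = λ r r≤ → ∈⇒≤∼ λ r∈I → forAll∈ λ d → ≤∼⇒∈ (r≤ d) r∈I
      }

  B : RawQuantifierTheory (AllSets ℓ ∪∅)
  B = raw at Z mod isFilter

  private
    absurd : ∀ {w} {W : Set w} → NonEmpty (Polymorphic.⊥ {ℓ}) → W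
    absurd ne = ⊥-elim (NonEmpty.notEmpty ne λ ())
    module IsQT = IsQuantifierTheory

  -- A theory over all sets tests closedness at its own 𝐀(∅) as well, which B
  -- has forgotten; a substitution into it factors through X ⊎ X.
  closed-from-nonempty : {X : Set ℓ} ⦃ _ : NonEmpty X ⦄ {p : Formula X} →
    (∀ {Y} → NonEmpty Y → (σ τ : Substitution X Y) → p ⟨ σ ⟩ F.≈ p ⟨ τ ⟩) → Closed p
  closed-from-nonempty {X} {p} p-closed σ τ _ = begin
    p ⟨ σ ⟩                                   ≈⟨ ⟨⟩-congʳ (λ x → P3 (inj₁ x) [ σ , τ ]′) ⟨
    p ⟨ (var ∘ inj₁) ⨾ [ σ , τ ]′ ⟩           ≈⟨ P2 p (var ∘ inj₁) [ σ , τ ]′ ⟨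
    p ⟨ var ∘ inj₁ ⟩ ⟨ [ σ , τ ]′ ⟩           ≈⟨ ⟨⟩-cong (p-closed it (var ∘ inj₁) (var ∘ inj₂)) (λ _ → T.refl) ⟩
    p ⟨ var ∘ inj₂ ⟩ ⟨ [ σ , τ ]′ ⟩           ≈⟨ P2 p (var ∘ inj₂) [ σ , τ ]′ ⟩
    p ⟨ (var ∘ inj₂) ⨾ [ σ , τ ]′ ⟩           ≈⟨ ⟨⟩-congʳ (λ x → P3 (inj₂ x) [ σ , τ ]′) ⟩
    p ⟨ τ ⟩                                   ∎
    where
    open ≈-Reasoning F.setoid
    instance
      X⊎X-nonEmpty : NonEmpty (X ⊎ X)
      X⊎X-nonEmpty = inhabited (inj₁ (element em it))

  -- Every axiom comes from A: substitutions out of ∅ are excluded by nonemptiness, and formula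
  -- equations landing at ∅ pass to the quotient.
  isQuantifierTheory-B : IsQuantifierTheory em B
  isQuantifierTheory-B .IsQT.⟨⟩ᵗ-cong {nothing} ⦃ ne ⦄ = absurd ne
  isQuantifierTheory-B .IsQT.⟨⟩ᵗ-cong {just X} {nothing} = ⟨⟩ᵗ-cong
  isQuantifierTheory-B .IsQT.⟨⟩ᵗ-cong {just X} {just Y}  = ⟨⟩ᵗ-cong
  isQuantifierTheory-B .IsQT.⟨⟩-cong {nothing} ⦃ ne ⦄ = absurd ne
  isQuantifierTheory-B .IsQT.⟨⟩-cong {just X} {nothing} p≈q σ≈τ = ≈⇒∼ (⟨⟩-cong p≈q σ≈τ)
  isQuantifierTheory-B .IsQT.⟨⟩-cong {just X} {just Y}  = ⟨⟩-cong
  isQuantifierTheory-B .IsQT.forAll-cong {just X} = forAll-cong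
  isQuantifierTheory-B .IsQT.P1ᵗ {nothing} ⦃ ne ⦄ = absurd ne
  isQuantifierTheory-B .IsQT.P1ᵗ {just X} = P1ᵗ
  isQuantifierTheory-B .IsQT.P1 {nothing} ⦃ ne ⦄ = absurd ne
  isQuantifierTheory-B .IsQT.P1 {just X} = P1
  isQuantifierTheory-B .IsQT.P2ᵗ {nothing} ⦃ ne ⦄ = absurd ne
  isQuantifierTheory-B .IsQT.P2ᵗ {just X} {nothing} ⦃ _ ⦄ ⦃ ne ⦄ = absurd ne
  isQuantifierTheory-B .IsQT.P2ᵗ {just X} {just Y} {nothing} = P2ᵗ
  isQuantifierTheory-B .IsQT.P2ᵗ {just X} {just Y} {just W}  = P2ᵗ
  isQuantifierTheory-B .IsQT.P2 {nothing} ⦃ ne ⦄ = absurd ne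
  isQuantifierTheory-B .IsQT.P2 {just X} {nothing} ⦃ _ ⦄ ⦃ ne ⦄ = absurd ne
  isQuantifierTheory-B .IsQT.P2 {just X} {just Y} {nothing} p σ τ = ≈⇒∼ (P2 p σ τ)
  isQuantifierTheory-B .IsQT.P2 {just X} {just Y} {just W}  = P2
  isQuantifierTheory-B .IsQT.P3 {nothing} ⦃ ne ⦄ = absurd ne
  isQuantifierTheory-B .IsQT.P3 {just X} {nothing} = P3
  isQuantifierTheory-B .IsQT.P3 {just X} {just Y}  = P3
  isQuantifierTheory-B .IsQT.P4 {nothing} ⦃ ne ⦄ = absurd ne
  isQuantifierTheory-B .IsQT.P4 {just X} {nothing} σ = record
    { isLatticeHomomorphism = record
      { isRelHomomorphism = record { cong = λ p≈q → ≈⇒∼ (⟨⟩-cong p≈q λ _ → T.refl) }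
      ; ∧-homo = λ p q → ≈⇒∼ (⟨⟩-∧ σ p q)
      ; ∨-homo = λ p q → ≈⇒∼ (⟨⟩-∨ σ p q)
      }
    ; ¬-homo = λ p → ≈⇒∼ (⟨⟩-¬ σ p)
    ; ⊤-homo = ≈⇒∼ (⟨⟩-⊤ σ)
    ; ⊥-homo = ≈⇒∼ (⟨⟩-⊥ σ)
    }
  isQuantifierTheory-B .IsQT.P4 {just X} {just Y} = P4
  isQuantifierTheory-B .IsQT.P5 {nothing} ⦃ ne ⦄ = absurd ne
  isQuantifierTheory-B .IsQT.P5 {just X} {nothing} ⦃ _ ⦄ ⦃ ne ⦄ = absurd ne
  isQuantifierTheory-B .IsQT.P5 {just X} {just Y} = P5
  isQuantifierTheory-B .IsQT.Q1 {just X} = Q1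
  isQuantifierTheory-B .IsQT.Q2 {just X} = Q2
  isQuantifierTheory-B .IsQT.Q3 {just X} = Q3
  isQuantifierTheory-B .IsQT.nontrivial =
    let X , ne , p , p-open = nontrivial in
    just (X , ne) , ne , p , λ p-closed → p-open (closed-from-nonempty ⦃ ne ⦄ λ {Y} Y-ne σ τ →
      p-closed {just (Y , Y-ne)} σ τ λ ())

  isModel : Is2ModelOf em raw B
  isModel = record
    { isModification = refl
    ; is2Model = record
      { isQuantifierModel = record
        { isQuantifierTheory = isQuantifierTheory-B
        ; o-empty     = λ ()
        ; M1-terms    = inhabited (var (element em Z-nonEmpty))
        ; M1-formulas = λ ⊥∼⊤ → ⊥∉ isUltrafilter (∈-resp-∼ (Q.sym ⊥∼⊤) ⊤-closed)
        ; M2          = λ { {nothing} ⦃ ne ⦄ → absurd ne ; {just X} → forAll-isInfimum }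
        }
      ; formulas≅2 = truth , quotient≅2
      }
    }
    where
    open Ultrafilters em (Formulas Z) using (⊥∉)
    module Q = BooleanAlgebra (quotient (Formulas Z) isFilter)

-- Gödel's completeness theorem

theorem7 : (em : ∀ {a} → ExcludedMiddle a) (ext : ∀ {a b} → Extensionality a b) →
  ∀ {ℓ} (A : QuantifierTheory em (AllSets ℓ)) →
  let open QuantifierTheory A in
  LocallyFinite →
  (X : Set ℓ) (X-infinite : Infinite X) (J : Pred (Formula X) ℓ) →
  Filters.Consistent (Formulas X) J →
  (Σ[ X⁺ ∈ Set ℓ ] Σ[ κ ∈ (X → X⁺) ] Σ[ I ∈ Pred (Formula X⁺) ℓ ]
    IsPerfectExtension A X-infinite J X⁺ κ I)
  ×
  (∀ (X⁺ : Set ℓ) (κ : X → X⁺) (I : Pred (Formula X⁺) ℓ) →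
    (pe : IsPerfectExtension A X-infinite J X⁺ κ I) →
    let B = raw at X⁺ mod IsPerfectExtension.isFilter pe
        B∅ = RawQuantifierTheory.Formulas B nothing
        X-nonEmpty = infinite⇒nonEmpty X-infinite
        X∈ = just (X , X-nonEmpty)
    in
    Is2ModelOf em raw B ×
    (∀ p → p ∈ J →
      BooleanAlgebra._≈_ B∅
        (RawQuantifierTheory._⟨_⟩ B {X∈} {nothing} ⦃ X-nonEmpty ⦄ p (var ∘ κ))
        (BooleanAlgebra.⊤ B∅)))
theorem7 em ext A locallyFinite X X-infinite J J-consistent =
  (X⁺ , κ , I , extension) , λ X⁺ κ I pe →
    let open IsPerfectExtension pe in
    PerfectModel.isModel em A locallyFinite infinite isPerfect ,
    λ p p∈J → Quotient.∈⇒∼⊤ _ isFilter (J⊆I p∈J)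
  where open Extension em ext A locallyFinite X X-infinite J J-consistent
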